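{- No random online function $F:2^\omega\to 2^\omega$ is one-to-one.
   Context: $2^{<\omega}$ is the set of finite binary strings, $\epsilon$ the empty string, and $y\upharpoonright n=(y(0),\dots,y(n-1))$. Let $\sigma_0=\epsilon,\sigma_1,\sigma_2,\dots$ list $2^{<\omega}$ in length-lexicographic order. Each $x\in 2^\omega$ codes the representing function $f_x:2^{<\omega}\setminus\{\epsilon\}\to\{0,1\}$ given by $f_x(\sigma_{n+1})=x(n)$ for all $n$, and the online function $F_x:2^\omega\to 2^\omega$ given by $F_x(y)=f_x(y\upharpoonright 1)\,f_x(y\upharpoonright 2)\,f_x(y\upharpoonright 3)\cdots$, i.e. $F_x(y)(n)=f_x(y\upharpoonright (n+1))$. A function $F$ is a random online function if $F=F_x$ for some $x\in 2^\omega$ that is Martin-Löf random with respect to the uniform measure on $2^\omega$. -}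

module Defs where

open import Data.Bool.Base as Bool using (Bool; true; false)
import Data.Bool.Properties as Bool
open import Data.Fin.Base using (Fin)
open import Data.Integer.Base using (+_)
open import Data.List.Base
  using (List; []; _∷_; length; map; _++_; foldl; foldr; filter; reverse; applyUpTo)
open import Data.List.Extrema.Nat using (max)
open import Data.List.Properties
  using (reverse-foldl; reverse-foldr; reverse-involutive)
open import Data.List.Relation.Binary.Lex.Strict using (Lex-<; base; halt; this; next)
open import Data.List.Relation.Binary.Prefix.Heterogeneous using (Prefix)
open import Data.List.Relation.Binary.Prefix.Heterogeneous.Properties using (prefix?)
open import Data.List.Relation.Unary.All using (All)
open import Data.List.Relation.Unary.Any using (any?)
open import Data.Nat.Base
open import Data.Nat.Properties
open import Data.Product.Base using (_×_; _,_; ∃-syntax)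
open import Data.Rational.Unnormalised.Base as ℚᵘ using (ℚᵘ)
open import Data.Sum.Base using (_⊎_; inj₁; inj₂)
open import Data.Vec.Base as Vec using (Vec)
open import Data.Vec.Relation.Binary.Pointwise.Inductive using (Pointwise)
open import Function.Definitions using (Injective)
open import Relation.Binary.PropositionalEquality
open import Relation.Nullary.Negation.Core using (¬_)

------------------------------------------------------------------------
-- Strings and infinite sequences (first bit at the head of the list)

String : Set
String = List Bool

-- Sequences are compared pointwise, by _≗_.
Cantor : Set
Cantor = ℕ → Bool

infix 8 _↾_

_↾_ : Cantor → ℕ → String
y ↾ n = applyUpTo y n

------------------------------------------------------------------------
-- The length-lexicographic listing of strings

_<ₗₗ_ : String → String → Set
s <ₗₗ t = length s < length t
        ⊎ (length s ≡ length t × Lex-< _≡_ Bool._<_ s t)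

-- Successor of a string, written with its last bit first; the carry out of
-- a string of ones produces the string of zeros that is one bit longer.
inc : String → String
inc []          = false ∷ []
inc (false ∷ r) = true ∷ r
inc (true ∷ r)  = false ∷ inc r

revσ : ℕ → String
revσ zero    = []
revσ (suc n) = inc (revσ n)

σ : ℕ → String
σ n = reverse (revσ n)

snocIndex : ℕ → Bool → ℕ
snocIndex i false = suc (i + i)
snocIndex i true  = suc (suc (i + i))

-- The position of a string in the listing: if s is σ i, then s0 and s1 are
-- σ (2i + 1) and σ (2i + 2).
index : String → ℕ
index = foldl snocIndex 0

-- index-σ, σ-index and index-mono below show that σ is a bijection ℕ → String
-- with inverse index, and that it lists strings in the order _<ₗₗ_.

private
  revIndex : String → ℕ
  revIndex = foldr (λ b i → snocIndex i b) 0

  revIndex-inc : ∀ r → revIndex (inc r) ≡ suc (revIndex r)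
  revIndex-inc []          = refl
  revIndex-inc (false ∷ r) = refl
  revIndex-inc (true ∷ r)  rewrite revIndex-inc r =
    cong (λ k → suc (suc k)) (+-suc (revIndex r) (revIndex r))

  revIndex-revσ : ∀ n → revIndex (revσ n) ≡ n
  revIndex-revσ zero    = refl
  revIndex-revσ (suc n) =
    trans (revIndex-inc (revσ n)) (cong suc (revIndex-revσ n))

  revσ-snoc0 : ∀ i → revσ (suc (i + i)) ≡ false ∷ revσ i
  revσ-snoc0 zero    = refl
  revσ-snoc0 (suc i) rewrite +-suc i i | revσ-snoc0 i = refl

  revσ-revIndex : ∀ r → revσ (revIndex r) ≡ r
  revσ-revIndex []          = refl
  revσ-revIndex (false ∷ r) =
    trans (revσ-snoc0 (revIndex r)) (cong (false ∷_) (revσ-revIndex r))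
  revσ-revIndex (true ∷ r)  =
    trans (cong inc (revσ-snoc0 (revIndex r))) (cong (true ∷_) (revσ-revIndex r))

  snoc-mono : ∀ {i j} b c → i < j → snocIndex i b < snocIndex j c
  snoc-mono {i} {j} b c i<j = ≤-trans (s≤s (upper b)) (≤-trans gap (lower c))
    where
    upper : ∀ b → snocIndex i b ≤ suc (suc (i + i))
    upper false = n≤1+n _
    upper true  = ≤-refl
    lower : ∀ c → suc (j + j) ≤ snocIndex j c
    lower false = ≤-refl
    lower true  = n≤1+n _
    gap : suc (suc (suc (i + i))) ≤ suc (j + j)
    gap = s≤s (subst (_≤ j + j) (cong suc (+-suc i i)) (+-mono-≤ i<j i<j))

  snoc-grow : ∀ {i} b → i < snocIndex i b
  snoc-grow {i} false = s≤s (m≤m+n i i)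
  snoc-grow {i} true  = m≤n⇒m≤1+n (s≤s (m≤m+n i i))

  foldl-mono : ∀ {i j} s t → length s ≤ length t → i < j →
               foldl snocIndex i s < foldl snocIndex j t
  foldl-mono []      []      _       i<j = i<j
  foldl-mono []      (c ∷ t) _       i<j = foldl-mono [] t z≤n (<-trans i<j (snoc-grow c))
  foldl-mono (b ∷ s) (c ∷ t) (s≤s l) i<j = foldl-mono s t l (snoc-mono b c i<j)

  foldl-lex : ∀ {i} s t → length s ≡ length t → Lex-< _≡_ Bool._<_ s t →
              foldl snocIndex i s < foldl snocIndex i t
  foldl-lex (_ ∷ s) (_ ∷ t) e (this Bool.f<t) =
    foldl-mono s t (≤-reflexive (suc-injective e)) ≤-refl
  foldl-lex (_ ∷ s) (_ ∷ t) e (next refl s<t) = foldl-lex s t (suc-injective e) s<t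

index-σ : ∀ n → index (σ n) ≡ n
index-σ n = trans (reverse-foldl snocIndex 0 (revσ n)) (revIndex-revσ n)

σ-index : ∀ s → σ (index s) ≡ s
σ-index s = begin
  reverse (revσ (index s))
    ≡⟨ cong (λ i → reverse (revσ i)) (reverse-foldr (λ b i → snocIndex i b) 0 s) ⟨
  reverse (revσ (revIndex (reverse s)))
    ≡⟨ cong reverse (revσ-revIndex (reverse s)) ⟩
  reverse (reverse s)
    ≡⟨ reverse-involutive s ⟩
  s ∎
  where open ≡-Reasoning

index-mono : ∀ s t → s <ₗₗ t → index s < index t
index-mono s       t       (inj₂ (e , s<t)) = foldl-lex s t e s<t
index-mono s       (c ∷ t) (inj₁ (s≤s l))   = foldl-mono s t l (snoc-grow c)

------------------------------------------------------------------------
-- Online functions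

-- Meaningful on nonempty strings only; the value at [] is junk and is never
-- used by F⟨_⟩.
f⟨_⟩ : Cantor → String → Bool
f⟨ x ⟩ s = x (pred (index s))

f-σ : ∀ x n → f⟨ x ⟩ (σ (suc n)) ≡ x n
f-σ x n = cong (λ i → x (pred i)) (index-σ (suc n))

F⟨_⟩ : Cantor → Cantor → Cantor
F⟨ x ⟩ y n = f⟨ x ⟩ (y ↾ suc n)

------------------------------------------------------------------------
-- Partial recursive functions

data Rec : ℕ → Set where
  zero : Rec 0
  succ : Rec 1
  proj : ∀ {k} → Fin k → Rec k
  comp : ∀ {k m} → Rec m → Vec (Rec k) m → Rec k
  prec : ∀ {k} → Rec k → Rec (2 + k) → Rec (suc k)
  mu   : ∀ {k} → Rec (suc k) → Rec k

infix 4 _⟨_⟩↦_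

-- f ⟨ v ⟩↦ w : the partial function coded by f is defined at v with value w.
data _⟨_⟩↦_ : ∀ {k} → Rec k → Vec ℕ k → ℕ → Set where
  zero     : zero ⟨ Vec.[] ⟩↦ 0
  succ     : ∀ {n} → succ ⟨ n Vec.∷ Vec.[] ⟩↦ suc n
  proj     : ∀ {k} (i : Fin k) {v} → proj i ⟨ v ⟩↦ Vec.lookup v i
  comp     : ∀ {k m} {f : Rec m} {gs : Vec (Rec k) m} {v ws w} →
             Pointwise (λ g u → g ⟨ v ⟩↦ u) gs ws → f ⟨ ws ⟩↦ w →
             comp f gs ⟨ v ⟩↦ w
  prec-zero : ∀ {k} {f : Rec k} {g v w} → f ⟨ v ⟩↦ w →
             prec f g ⟨ 0 Vec.∷ v ⟩↦ w
  prec-suc : ∀ {k} {f : Rec k} {g n v u w} → prec f g ⟨ n Vec.∷ v ⟩↦ u →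
             g ⟨ n Vec.∷ u Vec.∷ v ⟩↦ w →
             prec f g ⟨ suc n Vec.∷ v ⟩↦ w
  mu       : ∀ {k} {f : Rec (suc k)} {n v} → f ⟨ n Vec.∷ v ⟩↦ 0 →
             (∀ i → i < n → ∃[ u ] f ⟨ i Vec.∷ v ⟩↦ suc u) →
             mu f ⟨ v ⟩↦ n

------------------------------------------------------------------------
-- Uniform measure and Martin-Löf randomness

strings : ℕ → List String
strings zero    = [] ∷ []
strings (suc m) = map (false ∷_) (strings m) ++ map (true ∷_) (strings m)

infix 7 _/2^_

_/2^_ : ℕ → ℕ → ℚᵘ
k /2^ m = ((+ k) ℚᵘ./ (2 ^ m)) {{m^n≢0 2 m}}

-- Uniform measure of the clopen set of all sequences extending some string of
-- L: the proportion, among the strings whose length is the maximum length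
-- occurring in L, of those that extend a string of L.
measure : List String → ℚᵘ
measure L = length (filter (λ t → any? (λ s → prefix? Bool._≟_ s t) L) (strings m)) /2^ m
  where m = max 0 (map length L)

-- The domain of a partial recursive function of two arguments is the c.e. set
-- of pairs (n , s) with s ∈W[ c , n ]; the n-th open set is the union U[ c , n ]
-- of the cylinders of the strings in the n-th section.
_∈W[_,_] : String → Rec 2 → ℕ → Set
s ∈W[ c , n ] = ∃[ w ] c ⟨ n Vec.∷ index s Vec.∷ Vec.[] ⟩↦ w

_∈U[_,_] : Cantor → Rec 2 → ℕ → Set
x ∈U[ c , n ] = ∃[ s ] s ∈W[ c , n ] × x ↾ length s ≡ s

-- The measure of an open set is the supremum of the measures of the finite
-- subunions of its cylinders, so this says that U[ c , n ] has measure at most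
-- 2⁻ⁿ for every n.
IsMLTest : Rec 2 → Set
IsMLTest c = ∀ n (L : List String) → All (_∈W[ c , n ]) L → measure L ℚᵘ.≤ 1 /2^ n

-- x lies outside ⋂ₙ U[ c , n ] for every test c, where membership in U[ c , n ],
-- an unbounded existential, is read classically (hence ¬ ¬).  Under excluded
-- middle this is ¬ (∀ n → x ∈U[ c , n ]); constructively it is implied by
-- ∃[ n ] ¬ (x ∈U[ c , n ]) and implies ¬ (∀ n → x ∈U[ c , n ]).
MLRandom : Cantor → Set
MLRandom x = ∀ c → IsMLTest c → ¬ (∀ n → ¬ ¬ (x ∈U[ c , n ]))

RandomOnline : (Cantor → Cantor) → Set
RandomOnline F = ∃[ x ] MLRandom x × (∀ y → F y ≗ F⟨ x ⟩ y)

OneToOne : (Cantor → Cantor) → Set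
OneToOne = Injective _≗_ _≗_

{-# OPTIONS --safe #-}

-- Number the string s by suc (index s): the root is 1 and the children of v are 2v and 2v + 1.
-- Two nodes of one level whose branches carry the same labels split into equally labelled
-- pairs of children: (2v, 2w) if these labels agree, (2v + 1, 2w + 1) if those agree, and
-- (2v, 2w + 1) if neither happens and these two agree.  The descendants of different pairs are
-- labelled independently, so this is a branching process of mean 9/8, and its probability e(d)
-- of extinction by depth d satisfies 1/2 - (7/8)^d / 2 ≤ e(d) ≤ 1/2.
--
-- The test at k with L = k + 3 consists of two events.  Either no node u of level L has two
-- equally labelled children forming a pair that survives to depth 18(L + 1); these 2^L events
-- are independent and each has probability at most 3/4.  Or, for K = L + 1, some pair of
-- level K survives to depth 18K and yet dies out by depth 18(K + 1) + 1; this probability is at most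
-- 4^(K + 1) (7/8)^(18K) / 2.  Together they have measure at most 2^-(k + 1), and both are decided
-- by finitely many bits.  If x avoids the events from n on, a surviving pair exists and
-- can be extended computably forever, which gives two sequences with the same image.  Merely
-- surviving pairs would need weak König's lemma; the second event makes the choice effective.
module Submission where

open import Defs
open import Data.Bool.Base as Bool using (Bool; true; false; not; _∧_; _∨_; if_then_else_; T)
import Data.Bool.Properties as Bool
open import Data.Fin.Base as Fin using (Fin)
open import Data.Fin.Patterns using (0F; 1F; 2F; 3F; 4F; 5F; 6F)
import Data.Integer.Base as ℤ
import Data.Integer.Properties as ℤ
open import Data.List.Base as List using (List; length; filter)
open import Data.List.Extrema.Nat using (max; xs≤max)
open import Data.List.Properties
  using (filter-++; length-++; length-applyUpTo; applyUpTo-∷ʳ; foldl-∷ʳ)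
open import Data.List.Relation.Binary.Prefix.Heterogeneous using (Prefix; []; _∷_)
open import Data.List.Relation.Binary.Prefix.Heterogeneous.Properties using (prefix?)
open import Data.List.Relation.Unary.All using (All; []; _∷_)
import Data.List.Relation.Unary.All.Properties as All
open import Data.List.Relation.Unary.Any using (Any; here; there; any?)
open import Data.Nat.Base
open import Data.Nat.Properties
open import Data.Nat.Tactic.RingSolver using (solve-∀)
open import Data.Product.Base using (_×_; _,_; ∃-syntax; proj₁; proj₂)
import Data.Rational.Unnormalised.Base as ℚᵘ
open import Data.Sum.Base using (_⊎_; inj₁; inj₂; [_,_]′)
open import Data.Vec.Base as Vec using (Vec; []; _∷_)
import Data.Vec.Properties as Vec
open import Data.Vec.Relation.Binary.Pointwise.Inductive using (Pointwise; []; _∷_)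
open import Function.Base using (_∘_; id)
open import Relation.Binary.Definitions using (tri<; tri≈; tri>)
open import Relation.Binary.PropositionalEquality
open import Relation.Nullary.Decidable.Core using (Dec; yes; no; _⊎-dec_; toWitness)
open import Relation.Nullary.Negation.Core using (¬_; contradiction)
open import Relation.Unary using (Decidable)

-- Total recursive functions

𝟙 : Bool → ℕ
𝟙 b = if b then 1 else 0

-- Value and program are built together: a decider is written once as a term, and what it computes
-- can then be treated as an ordinary function.
record Fun (k : ℕ) : Set where
  constructor mkFun
  field
    fun     : Vec ℕ k → ℕ
    code    : Rec k
    correct : ∀ v → code ⟨ v ⟩↦ fun v

open Fun

record Pred (k : ℕ) : Set where
  constructor mkPred
  field
    holds   : Vec ℕ k → Bool
    code    : Rec k
    correct : ∀ v → code ⟨ v ⟩↦ 𝟙 (holds v)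

open Pred using (holds)

Computes₂ : Rec 2 → (ℕ → ℕ → ℕ) → Set
Computes₂ c f = ∀ a b → c ⟨ a ∷ b ∷ [] ⟩↦ f a b

var : ∀ {k} → Fin k → Fun k
var i = mkFun (λ v → Vec.lookup v i) (proj i) (λ _ → proj i)

constant : ∀ {k} → ℕ → Rec k
constant zero    = comp zero []
constant (suc n) = comp succ (constant n ∷ [])

constant-correct : ∀ {k} n (v : Vec ℕ k) → constant n ⟨ v ⟩↦ n
constant-correct zero    v = comp [] zero
constant-correct (suc n) v = comp (constant-correct n v ∷ []) succ

lit : ∀ {k} → ℕ → Fun k
lit n = mkFun (λ _ → n) (constant n) (constant-correct n)

binary : ∀ {k} (f : ℕ → ℕ → ℕ) {c : Rec 2} → Computes₂ c f → Fun k → Fun k → Fun k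
binary f {c} correct-c a b = mkFun (λ v → f (fun a v) (fun b v))
  (comp c (code a ∷ code b ∷ []))
  (λ v → comp (correct a v ∷ correct b v ∷ []) (correct-c _ _))

add-code : Rec 2
add-code = prec (proj 0F) (comp succ (proj 1F ∷ []))

add-correct : Computes₂ add-code _+_
add-correct zero    b = prec-zero (proj 0F)
add-correct (suc a) b = prec-suc (add-correct a b) (comp (proj 1F ∷ []) succ)

mul-code : Rec 2
mul-code = prec (comp zero []) (comp add-code (proj 2F ∷ proj 1F ∷ []))

mul-correct : Computes₂ mul-code _*_
mul-correct zero    b = prec-zero (comp [] zero)
mul-correct (suc a) b = prec-suc (mul-correct a b)
  (comp (proj 2F ∷ proj 1F ∷ []) (add-correct b (a * b)))

pred-code : Rec 1
pred-code = prec zero (proj 0F)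

pred-correct : ∀ n → pred-code ⟨ n ∷ [] ⟩↦ pred n
pred-correct zero    = prec-zero zero
pred-correct (suc n) = prec-suc (pred-correct n) (proj 0F)

-- `prec` recurses on its first argument, so the subtrahend has to come first.
flipped-monus-code : Rec 2
flipped-monus-code = prec (proj 0F) (comp pred-code (proj 1F ∷ []))

flipped-monus-correct : Computes₂ flipped-monus-code (λ b a → a ∸ b)
flipped-monus-correct zero    a = prec-zero (proj 0F)
flipped-monus-correct (suc b) a =
  subst (flipped-monus-code ⟨ suc b ∷ a ∷ [] ⟩↦_) (pred[m∸n]≡m∸[1+n] a b)
    (prec-suc (flipped-monus-correct b a) (comp (proj 1F ∷ []) (pred-correct (a ∸ b))))

-- Rests on the recursion ⌊(n + 1)/2⌋ = n - ⌊n/2⌋, which needs no parity test.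
half-code : Rec 1
half-code = prec zero (comp flipped-monus-code (proj 1F ∷ proj 0F ∷ []))

half-correct : ∀ n → half-code ⟨ n ∷ [] ⟩↦ ⌊ n /2⌋
half-correct zero    = prec-zero zero
half-correct (suc n) = subst (half-code ⟨ suc n ∷ [] ⟩↦_) eq
  (prec-suc (half-correct n)
    (comp (proj 1F ∷ proj 0F ∷ []) (flipped-monus-correct ⌊ n /2⌋ n)))
  where
  eq : n ∸ ⌊ n /2⌋ ≡ ⌊ suc n /2⌋
  eq = trans (cong (_∸ ⌊ n /2⌋) (sym (⌊n/2⌋+⌈n/2⌉≡n n))) (m+n∸m≡n ⌊ n /2⌋ ⌈ n /2⌉)

infixl 8 _≫_

-- On tree nodes this is the ancestor d levels up, because v is the parent of 2v and 2v + 1.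
_≫_ : ℕ → ℕ → ℕ
n ≫ zero  = n
n ≫ suc d = ⌊ n ≫ d /2⌋

flipped-shift-code : Rec 2
flipped-shift-code = prec (proj 0F) (comp half-code (proj 1F ∷ []))

flipped-shift-correct : Computes₂ flipped-shift-code (λ d n → n ≫ d)
flipped-shift-correct zero    n = prec-zero (proj 0F)
flipped-shift-correct (suc d) n =
  prec-suc (flipped-shift-correct d n) (comp (proj 1F ∷ []) (half-correct _))

pow2-code : Rec 1
pow2-code = prec (constant 1)
  (comp mul-code (constant 2 ∷ proj 1F ∷ []))

pow2-correct : ∀ n → pow2-code ⟨ n ∷ [] ⟩↦ 2 ^ n
pow2-correct zero    = prec-zero (constant-correct 1 [])
pow2-correct (suc n) = prec-suc (pow2-correct n)
  (comp (constant-correct 2 _ ∷ proj 1F ∷ []) (mul-correct 2 (2 ^ n)))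

infixl 6 _⊕_ _⊖_
infixl 7 _⊗_
infixl 8 _⊳_

_⊕_ _⊖_ _⊗_ _⊳_ : ∀ {k} → Fun k → Fun k → Fun k
_⊕_     = binary _+_ add-correct
a ⊖ b   = binary (λ b a → a ∸ b) flipped-monus-correct b a
_⊗_     = binary _*_ mul-correct
a ⊳ d   = binary (λ d a → a ≫ d) flipped-shift-correct d a

pow2 : ∀ {k} → Fun k → Fun k
pow2 a = mkFun (λ v → 2 ^ fun a v) (comp pow2-code (code a ∷ []))
  (λ v → comp (correct a v ∷ []) (pow2-correct _))

predicate : ∀ {k} (p : Vec ℕ k → Bool) (f : Fun k) → (∀ v → fun f v ≡ 𝟙 (p v)) → Pred k
predicate p f eq = mkPred p (code f) (λ v → subst (code f ⟨ v ⟩↦_) (eq v) (correct f v))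

indicator : ∀ {k} → Pred k → Fun k
indicator p = mkFun (λ v → 𝟙 (holds p v)) (Pred.code p) (Pred.correct p)

infix  5 _≐_
infixr 4 _&_ _or_

_≐_ : ∀ {k} → Fun k → Fun k → Pred k
a ≐ b = predicate (λ v → fun a v ≡ᵇ fun b v) (lit 1 ⊖ ((a ⊖ b) ⊕ (b ⊖ a)))
  (λ v → eq (fun a v) (fun b v))
  where
  eq : ∀ m n → 1 ∸ ((m ∸ n) + (n ∸ m)) ≡ 𝟙 (m ≡ᵇ n)
  eq zero    zero    = refl
  eq zero    (suc n) = 0∸n≡0 n
  eq (suc m) zero    = 0∸n≡0 (m + 0)
  eq (suc m) (suc n) = eq m n

neg : ∀ {k} → Pred k → Pred k
neg p = predicate (λ v → not (holds p v)) (lit 1 ⊖ indicator p) (λ v → eq (holds p v))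
  where
  eq : ∀ a → 1 ∸ 𝟙 a ≡ 𝟙 (not a)
  eq false = refl
  eq true  = refl

𝟙-∧ : ∀ a b → 𝟙 (a ∧ b) ≡ 𝟙 a * 𝟙 b
𝟙-∧ false b = refl
𝟙-∧ true  b = sym (+-identityʳ (𝟙 b))

monus-∨ : ∀ a b → 1 ∸ (1 ∸ (𝟙 a + 𝟙 b)) ≡ 𝟙 (a ∨ b)
monus-∨ false false = refl
monus-∨ false true  = refl
monus-∨ true  b     = cong (1 ∸_) (0∸n≡0 (𝟙 b))

_&_ _or_ : ∀ {k} → Pred k → Pred k → Pred k
p & q = predicate (λ v → holds p v ∧ holds q v) (indicator p ⊗ indicator q)
  (λ v → sym (𝟙-∧ (holds p v) (holds q v)))
p or q = predicate (λ v → holds p v ∨ holds q v) (lit 1 ⊖ (lit 1 ⊖ (indicator p ⊕ indicator q)))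
  (λ v → monus-∨ (holds p v) (holds q v))

anyBelow allBelow : ℕ → (ℕ → Bool) → Bool
anyBelow zero    p = false
anyBelow (suc n) p = p n ∨ anyBelow n p
allBelow n p = not (anyBelow n (not ∘ p))

projections-correct : ∀ {k m} (v : Vec ℕ k) (ix : Fin m → Fin k) →
  Pointwise (λ g u → g ⟨ v ⟩↦ u) (Vec.tabulate (proj ∘ ix)) (Vec.tabulate (Vec.lookup v ∘ ix))
projections-correct {m = zero}  v ix = []
projections-correct {m = suc m} v ix = proj (ix 0F) ∷ projections-correct v (ix ∘ Fin.suc)

any< all< : ∀ {k} → Fun k → Pred (suc k) → Pred k
any< {k} n p = mkPred (λ v → anyBelow (fun n v) (λ i → holds p (i ∷ v)))
  (comp search (code n ∷ Vec.tabulate proj))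
  (λ v → comp (correct n v ∷ projections-correct v id)
    (subst (λ w → search ⟨ fun n v ∷ w ⟩↦ 𝟙 (anyBelow (fun n v) (λ i → holds p (i ∷ v))))
      (sym (Vec.tabulate∘lookup v)) (search-correct (fun n v) v)))
  where
  -- The step of `prec` receives counter, accumulated value and parameters; the accumulated value is
  -- skipped before `p` is called.
  current : Rec (2 + k)
  current = comp (Pred.code p) (proj 0F ∷ Vec.tabulate (λ i → proj (Fin.suc (Fin.suc i))))

  step : Pred (2 + k)
  step = mkPred (λ { (i ∷ r ∷ v) → holds p (i ∷ v) }) current
    (λ { (i ∷ r ∷ v) → comp (proj 0F ∷ projections-correct (i ∷ r ∷ v) (λ j → Fin.suc (Fin.suc j)))
      (subst (λ w → Pred.code p ⟨ i ∷ w ⟩↦ 𝟙 (holds p (i ∷ v)))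
        (sym (Vec.tabulate∘lookup v)) (Pred.correct p (i ∷ v))) })

  join : Fun (2 + k)
  join = lit 1 ⊖ (lit 1 ⊖ (indicator step ⊕ var 1F))

  search : Rec (suc k)
  search = prec (constant 0) (code join)

  search-correct : ∀ n v → search ⟨ n ∷ v ⟩↦ 𝟙 (anyBelow n (λ i → holds p (i ∷ v)))
  search-correct zero    v = prec-zero (constant-correct 0 v)
  search-correct (suc n) v = prec-suc (search-correct n v)
    (subst (code join ⟨ n ∷ r ∷ v ⟩↦_) (monus-∨ (holds p (n ∷ v)) _) (correct join (n ∷ r ∷ v)))
    where
    r : ℕ
    r = 𝟙 (anyBelow n (λ i → holds p (i ∷ v)))
all< n p = neg (any< n (neg p))

-- Sums over bit sequences

infixr 5 _◂_

_◂_ : Bool → Cantor → Cantor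
(b ◂ z) zero    = b
(b ◂ z) (suc n) = z n

-- This is 2^m times the expectation over the first m bits, the others being `false`. Probabilities
-- appear below as such sums compared with 2^m, so that all estimates stay in the natural numbers.
∑ : ℕ → (Cantor → ℕ) → ℕ
∑ zero    f = f (λ _ → false)
∑ (suc m) f = ∑ m (f ∘ (false ◂_)) + ∑ m (f ∘ (true ◂_))

-- The support is a predicate, so that independence can be stated through a set of positions and its
-- complement.
DependsOn : ∀ {A : Set} → (Cantor → A) → (ℕ → Set) → Set
DependsOn f S = ∀ z z′ → (∀ n → S n → z n ≡ z′ n) → f z ≡ f z′

dependsOn-mono : ∀ {A : Set} {f : Cantor → A} {S T : ℕ → Set} →
  (∀ {n} → S n → T n) → DependsOn f S → DependsOn f T
dependsOn-mono S⊆T dep z z′ eq = dep z z′ (λ n n∈S → eq n (S⊆T n∈S))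

dependsOn-◂ : ∀ {A : Set} {f : Cantor → A} {S : ℕ → Set} b →
  DependsOn f S → DependsOn (f ∘ (b ◂_)) (S ∘ suc)
dependsOn-◂ b dep z z′ eq = dep (b ◂ z) (b ◂ z′) λ where
  zero    _ → refl
  (suc n) p → eq n p

dependsOn-head : ∀ {A : Set} {f : Cantor → A} {S : ℕ → Set} →
  ¬ S 0 → DependsOn f S → ∀ z → f (false ◂ z) ≡ f (true ◂ z)
dependsOn-head 0∉S dep z = dep (false ◂ z) (true ◂ z) λ where
  zero    0∈S → contradiction 0∈S 0∉S
  (suc n) _   → refl

∑-cong : ∀ m {f g : Cantor → ℕ} → (∀ z → f z ≡ g z) → ∑ m f ≡ ∑ m g
∑-cong zero    eq = eq _
∑-cong (suc m) eq = cong₂ _+_ (∑-cong m (λ z → eq (false ◂ z))) (∑-cong m (λ z → eq (true ◂ z)))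

∑-mono : ∀ m {f g : Cantor → ℕ} → (∀ z → f z ≤ g z) → ∑ m f ≤ ∑ m g
∑-mono zero    le = le _
∑-mono (suc m) le = +-mono-≤ (∑-mono m (λ z → le (false ◂ z))) (∑-mono m (λ z → le (true ◂ z)))

interchange : ∀ a b c d → a + b + (c + d) ≡ a + c + (b + d)
interchange = solve-∀

∑-+ : ∀ m (f g : Cantor → ℕ) → ∑ m (λ z → f z + g z) ≡ ∑ m f + ∑ m g
∑-+ zero    f g = refl
∑-+ (suc m) f g = trans
  (cong₂ _+_ (∑-+ m (f ∘ (false ◂_)) (g ∘ (false ◂_))) (∑-+ m (f ∘ (true ◂_)) (g ∘ (true ◂_))))
  (interchange (∑ m (f ∘ (false ◂_))) _ _ _)

∑-zero : ∀ m → ∑ m (λ _ → 0) ≡ 0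
∑-zero zero    = refl
∑-zero (suc m) = cong₂ _+_ (∑-zero m) (∑-zero m)

∑-one : ∀ m → ∑ m (λ _ → 1) ≡ 2 ^ m
∑-one zero    = refl
∑-one (suc m) = cong₂ _+_ (∑-one m) (trans (∑-one m) (sym (+-identityʳ (2 ^ m))))

-- The expectation of a product over disjoint supports factors. In the induction the first bit
-- influences only one of the factors, so the other has equal sums over both halves.
independent : ∀ m {S : ℕ → Set} → (∀ n → Dec (S n)) → {f g : Cantor → ℕ} →
  DependsOn f S → DependsOn g (λ n → ¬ S n) →
  2 ^ m * ∑ m (λ z → f z * g z) ≡ ∑ m f * ∑ m g
independent zero    S? {f} {g} df dg = +-identityʳ (f _ * g _)
independent (suc m) {S} S? {f} {g} df dg = split (S? 0)
  where
  shifted : ∀ b c → 2 ^ m * ∑ m (λ z → f (b ◂ z) * g (c ◂ z)) ≡ ∑ m (f ∘ (b ◂_)) * ∑ m (g ∘ (c ◂_))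
  shifted b c = independent m (S? ∘ suc) (dependsOn-◂ b df) (dependsOn-◂ c dg)

  M a₀ a₁ c₀ c₁ : ℕ
  M  = 2 ^ m
  a₀ = ∑ m (f ∘ (false ◂_))
  a₁ = ∑ m (f ∘ (true ◂_))
  c₀ = ∑ m (g ∘ (false ◂_))
  c₁ = ∑ m (g ∘ (true ◂_))

  gather : ∀ {p q} → M * p ≡ a₀ * c₀ → M * q ≡ a₁ * c₁ →
    2 * M * (p + q) ≡ 2 * (a₀ * c₀ + a₁ * c₁)
  gather {p} {q} ep eq = trans (lemma M p q) (cong (2 *_) (cong₂ _+_ ep eq))
    where
    lemma : ∀ M p q → 2 * M * (p + q) ≡ 2 * (M * p + M * q)
    lemma = solve-∀

  split : Dec (S 0) → 2 * M * ∑ (suc m) (λ z → f z * g z) ≡ (a₀ + a₁) * (c₀ + c₁)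
  split (yes 0∈S) = trans (gather (shifted false false) (shifted true true)) (trans
    (cong (λ c → 2 * (a₀ * c + a₁ * c₁)) c₀≡c₁)
    (trans (lemma a₀ a₁ c₁) (cong (λ c → (a₀ + a₁) * (c + c₁)) (sym c₀≡c₁))))
    where
    c₀≡c₁ : c₀ ≡ c₁
    c₀≡c₁ = ∑-cong m (dependsOn-head (λ 0∉S → 0∉S 0∈S) dg)
    lemma : ∀ a b c → 2 * (a * c + b * c) ≡ (a + b) * (c + c)
    lemma = solve-∀
  split (no 0∉S) = trans (gather (shifted false false) (shifted true true)) (trans
    (cong (λ a → 2 * (a * c₀ + a₁ * c₁)) a₀≡a₁)
    (trans (lemma a₁ c₀ c₁) (cong (λ a → (a + a₁) * (c₀ + c₁)) (sym a₀≡a₁))))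
    where
    a₀≡a₁ : a₀ ≡ a₁
    a₀≡a₁ = ∑-cong m (dependsOn-head 0∉S df)
    lemma : ∀ a b c → 2 * (a * b + a * c) ≡ (a + a) * (b + c)
    lemma = solve-∀

-- Conditioning on bit i: once its value is fixed as a parameter, what remains does not depend on
-- it.
∑-fresh : ∀ m {i} → i < m → (g : Bool → Cantor → ℕ) → (∀ b → DependsOn (g b) (_≢ i)) →
  2 * ∑ m (λ z → g (z i) z) ≡ ∑ m (g false) + ∑ m (g true)
∑-fresh (suc m) {zero} _ g dep = trans (lemma (x false false) (x true true))
  (cong₂ (λ a b → (x false false + a) + (b + x true true)) (same false) (sym (same true)))
  where
  x : Bool → Bool → ℕ
  x b c = ∑ m (g b ∘ (c ◂_))
  same : ∀ b → x b false ≡ x b true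
  same b = ∑-cong m (dependsOn-head (λ ne → ne refl) (dep b))
  lemma : ∀ a b → 2 * (a + b) ≡ (a + a) + (b + b)
  lemma = solve-∀
∑-fresh (suc m) {suc i} (s≤s i<m) g dep =
  trans (*-distribˡ-+ 2 (∑ m (λ z → g (z i) (false ◂ z))) (∑ m (λ z → g (z i) (true ◂ z))))
    (trans (cong₂ _+_ (shifted false) (shifted true)) (interchange (∑ m (g false ∘ (false ◂_))) _ _ _))
  where
  shifted : ∀ c → 2 * ∑ m (λ z → g (z i) (c ◂ z)) ≡ ∑ m (g false ∘ (c ◂_)) + ∑ m (g true ∘ (c ◂_))
  shifted c = ∑-fresh m i<m (λ b → g b ∘ (c ◂_))
    (λ b → dependsOn-mono (λ ne eq → ne (cong suc eq)) (dependsOn-◂ c (dep b)))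

-- Boolean reflection

not-true : ∀ {a} → ¬ (a ≡ true) → a ≡ false
not-true {false} _ = refl
not-true {true}  n = contradiction refl n

∧-intro : ∀ {a b} → a ≡ true → b ≡ true → a ∧ b ≡ true
∧-intro refl refl = refl

∧-elim : ∀ {a b} → a ∧ b ≡ true → a ≡ true × b ≡ true
∧-elim {true} eq = refl , eq

∨-introˡ : ∀ {a b} → a ≡ true → a ∨ b ≡ true
∨-introˡ refl = refl

∨-introʳ : ∀ {a b} → b ≡ true → a ∨ b ≡ true
∨-introʳ {a} refl = Bool.∨-zeroʳ a

∨-elim : ∀ {a b} → a ∨ b ≡ true → a ≡ true ⊎ b ≡ true
∨-elim {false} eq = inj₂ eq
∨-elim {true}  _  = inj₁ refl

∨-false : ∀ {a b} → a ∨ b ≡ false → a ≡ false × b ≡ false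
∨-false {false} eq = refl , eq

not-false : ∀ {a} → not a ≡ false → a ≡ true
not-false {true} _ = refl

T⇒≡ : ∀ {a} → T a → a ≡ true
T⇒≡ {true} _ = refl

≡⇒T : ∀ {a} → a ≡ true → T a
≡⇒T refl = _

≤ᵇ-true : ∀ {m n} → m ≤ n → (m ≤ᵇ n) ≡ true
≤ᵇ-true = T⇒≡ ∘ ≤⇒≤ᵇ

≤ᵇ-sound : ∀ m {n} → (m ≤ᵇ n) ≡ true → m ≤ n
≤ᵇ-sound m eq = ≤ᵇ⇒≤ m _ (≡⇒T eq)

≡ᵇ-true : ∀ {m n} → m ≡ n → (m ≡ᵇ n) ≡ true
≡ᵇ-true {m} {n} = T⇒≡ ∘ ≡⇒≡ᵇ m n

≡ᵇ-sound : ∀ m {n} → (m ≡ᵇ n) ≡ true → m ≡ n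
≡ᵇ-sound m eq = ≡ᵇ⇒≡ m _ (≡⇒T eq)

anyBelow-intro : ∀ {n p i} → i < n → p i ≡ true → anyBelow n p ≡ true
anyBelow-intro {suc n} {p} {i} i<1+n pi with m≤n⇒m<n∨m≡n (≤-pred i<1+n)
... | inj₁ i<n  = ∨-introʳ {p n} (anyBelow-intro i<n pi)
... | inj₂ refl = ∨-introˡ pi

anyBelow-elim : ∀ {n p} → anyBelow n p ≡ true → ∃[ i ] i < n × p i ≡ true
anyBelow-elim {suc n} {p} eq with ∨-elim {p n} eq
... | inj₁ pn = n , ≤-refl , pn
... | inj₂ rest with anyBelow-elim rest
...   | i , i<n , pi = i , m≤n⇒m≤1+n i<n , pi

anyBelow-cong : ∀ n {p q : ℕ → Bool} → (∀ i → i < n → p i ≡ q i) → anyBelow n p ≡ anyBelow n q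
anyBelow-cong zero    eq = refl
anyBelow-cong (suc n) eq = cong₂ _∨_ (eq n ≤-refl) (anyBelow-cong n (λ i i<n → eq i (m≤n⇒m≤1+n i<n)))

allBelow-elim : ∀ {n p i} → allBelow n p ≡ true → i < n → p i ≡ true
allBelow-elim {n} {p} {i} eq i<n with p i in pi
... | true  = refl
... | false = contradiction (trans (sym eq) (cong not (anyBelow-intro i<n (cong not pi)))) λ ()

allBelow-intro : ∀ {n p} → (∀ i → i < n → p i ≡ true) → allBelow n p ≡ true
allBelow-intro {n} {p} h with anyBelow n (not ∘ p) in eq
... | false = refl
... | true with anyBelow-elim eq
...   | i , i<n , ¬pi = contradiction (trans (sym ¬pi) (cong not (h i i<n))) λ ()

-- Random sequences and Borel–Cantelli

-- Needed to read off from a halting computation of the test that the decider accepted: its value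
-- must be the one given by the correctness proof.
deterministic : ∀ {k} {f : Rec k} {v a b} → f ⟨ v ⟩↦ a → f ⟨ v ⟩↦ b → a ≡ b
deterministic* : ∀ {k m} {gs : Vec (Rec k) m} {v as bs} →
  Pointwise (λ g u → g ⟨ v ⟩↦ u) gs as → Pointwise (λ g u → g ⟨ v ⟩↦ u) gs bs → as ≡ bs
deterministic zero zero = refl
deterministic succ succ = refl
deterministic (proj i) (proj .i) = refl
deterministic (comp gs f) (comp gs′ f′) with deterministic* gs gs′
... | refl = deterministic f f′
deterministic (prec-zero f) (prec-zero f′) = deterministic f f′
deterministic (prec-suc r g) (prec-suc r′ g′) with deterministic r r′
... | refl = deterministic g g′
deterministic (mu {n = a} za below-a) (mu {n = b} zb below-b) with <-cmp a b
... | tri≈ _ a≡b _ = a≡b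
... | tri< a<b _ _ with below-b a a<b
...   | _ , sa = contradiction (deterministic za sa) λ ()
deterministic (mu {n = a} za below-a) (mu {n = b} zb below-b) | tri> _ _ b<a with below-a b b<a
...   | _ , sb = contradiction (deterministic zb sb) λ ()
deterministic* []       []         = refl
deterministic* (g ∷ gs) (g′ ∷ gs′) = cong₂ _∷_ (deterministic g g′) (deterministic* gs gs′)

-- The least zero may lie below `l`. A linear search from 0 with invariant `fuel + n ≡ l` finds it
-- no later than at `l`.
mu-defined : ∀ {k} (f : Fun (suc k)) v l → Fun.fun f (l ∷ v) ≡ 0 → ∃[ w ] mu (Fun.code f) ⟨ v ⟩↦ w
mu-defined f v l eq = search l 0 (+-identityʳ l) (λ _ ())
  where
  Below : ℕ → Set
  Below n = ∀ i → i < n → ∃[ u ] Fun.code f ⟨ i ∷ v ⟩↦ suc u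

  search : ∀ fuel n → fuel + n ≡ l → Below n → ∃[ w ] mu (Fun.code f) ⟨ v ⟩↦ w
  search fuel n bound below with Fun.fun f (n ∷ v) in eq′ | Fun.correct f (n ∷ v)
  search fuel       n bound below | zero  | value = n , mu value below
  search zero       n refl  below | suc u | value = contradiction (trans (sym eq) eq′) λ ()
  search (suc fuel) n bound below | suc u | value =
    search fuel (suc n) (trans (+-suc fuel n) bound) below′
    where
    below′ : Below (suc n)
    below′ i i<1+n with m≤n⇒m<n∨m≡n (≤-pred i<1+n)
    ... | inj₁ i<n  = below i i<n
    ... | inj₂ refl = u , value

pad : String → Cantor
pad List.[]      = λ _ → false
pad (b List.∷ s) = b ◂ pad s

pad-↾ : ∀ x n i → i < n → pad (x ↾ n) i ≡ x i
pad-↾ x (suc n) zero    _         = refl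
pad-↾ x (suc n) (suc i) (s≤s i<n) = pad-↾ (x ∘ suc) n i i<n

pad-prefix : ∀ {s t} → Prefix _≡_ s t → ∀ i → i < length s → pad s i ≡ pad t i
pad-prefix (refl ∷ p) zero    _         = refl
pad-prefix (refl ∷ p) (suc i) (s≤s i<n) = pad-prefix p i i<n

length-filter-map : ∀ {A B : Set} {P : B → Set} (P? : Decidable P) (f : A → B) xs →
  length (filter P? (List.map f xs)) ≡ length (filter (P? ∘ f) xs)
length-filter-map P? f List.[]       = refl
length-filter-map P? f (x List.∷ xs) with P? (f x)
... | yes _ = cong suc (length-filter-map P? f xs)
... | no  _ = length-filter-map P? f xs

-- `strings` and `∑` split on the first bit in the same way; this turns the count in `measure` into
-- a sum.
filter-strings-≤ : ∀ m {P : String → Set} (P? : Decidable P) (φ : Cantor → Bool) →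
  (∀ t → P t → φ (pad t) ≡ true) → length (filter P? (strings m)) ≤ ∑ m (𝟙 ∘ φ)
filter-strings-≤ zero    P? φ imp with P? List.[]
... | yes p = ≤-reflexive (cong 𝟙 (sym (imp List.[] p)))
... | no  _ = z≤n
filter-strings-≤ (suc m) P? φ imp
  rewrite filter-++ P? (List.map (false List.∷_) (strings m)) (List.map (true List.∷_) (strings m))
        | length-++ (filter P? (List.map (false List.∷_) (strings m)))
                    {filter P? (List.map (true List.∷_) (strings m))}
        | length-filter-map P? (false List.∷_) (strings m)
        | length-filter-map P? (true List.∷_) (strings m) =
  +-mono-≤ (filter-strings-≤ m (P? ∘ (false List.∷_)) (φ ∘ (false ◂_)) (λ t → imp (false List.∷ t)))
           (filter-strings-≤ m (P? ∘ (true List.∷_)) (φ ∘ (true ◂_)) (λ t → imp (true List.∷ t)))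

𝟙-∨ : ∀ a b → 𝟙 (a ∨ b) ≤ 𝟙 a + 𝟙 b
𝟙-∨ false b = ≤-refl
𝟙-∨ true  b = s≤s z≤n

∑-∨ : ∀ m (φ ψ : Cantor → Bool) → ∑ m (λ z → 𝟙 (φ z ∨ ψ z)) ≤ ∑ m (𝟙 ∘ φ) + ∑ m (𝟙 ∘ ψ)
∑-∨ m φ ψ = ≤-trans (∑-mono m (λ z → 𝟙-∨ (φ z) (ψ z))) (≤-reflexive (∑-+ m (𝟙 ∘ φ) (𝟙 ∘ ψ)))

-- Sums the geometric series of the bounds 2^-(n + l + 1) over l.
∑-anyBelow : ∀ m n (φ : ℕ → Cantor → Bool) →
  (∀ l → 2 ^ suc (n + l) * ∑ m (𝟙 ∘ φ l) ≤ 2 ^ m) →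
  ∀ Λ → 2 ^ n * ∑ m (λ z → 𝟙 (anyBelow Λ (λ l → φ l z))) ≤ 2 ^ m
∑-anyBelow m n φ small Λ = *-cancelˡ-≤ (2 ^ Λ) {{m^n≢0 2 Λ}} (begin
  2 ^ Λ * (2 ^ n * S Λ) ≡⟨ *-assoc (2 ^ Λ) (2 ^ n) (S Λ) ⟨
  2 ^ Λ * 2 ^ n * S Λ   ≡⟨ cong (_* S Λ) (trans (*-comm (2 ^ Λ) (2 ^ n)) (sym (^-distribˡ-+-* 2 n Λ))) ⟩
  2 ^ (n + Λ) * S Λ     ≤⟨ m≤m+n _ _ ⟩
  2 ^ (n + Λ) * S Λ + 2 ^ m ≤⟨ geometric Λ ⟩
  2 ^ Λ * 2 ^ m         ∎)
  where
  open ≤-Reasoning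
  S : ℕ → ℕ
  S Λ = ∑ m (λ z → 𝟙 (anyBelow Λ (λ l → φ l z)))

  expand : ∀ a s t b → 2 * a * (s + t) + b + b ≡ 2 * (a * t + b) + 2 * a * s
  expand = solve-∀

  collect : ∀ a b → 2 * (a * b) + b ≡ 2 * a * b + b
  collect = solve-∀

  -- The induction needs the exact partial sum: the first Λ events have total measure at most 2^-n -
  -- 2^-(n + Λ).
  geometric : ∀ Λ → 2 ^ (n + Λ) * S Λ + 2 ^ m ≤ 2 ^ Λ * 2 ^ m
  geometric zero = begin
    2 ^ (n + 0) * S 0 + 2 ^ m ≡⟨ cong (λ s → 2 ^ (n + 0) * s + 2 ^ m) (∑-zero m) ⟩
    2 ^ (n + 0) * 0 + 2 ^ m   ≡⟨ cong (_+ 2 ^ m) (*-zeroʳ (2 ^ (n + 0))) ⟩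
    2 ^ m                     ≡⟨ +-identityʳ (2 ^ m) ⟨
    1 * 2 ^ m                 ∎
  geometric (suc Λ) = +-cancelʳ-≤ (2 ^ m) _ _ (begin
    2 ^ (n + suc Λ) * S (suc Λ) + 2 ^ m + 2 ^ m
      ≤⟨ +-monoˡ-≤ (2 ^ m) (+-monoˡ-≤ (2 ^ m) (*-monoʳ-≤ (2 ^ (n + suc Λ)) (∑-∨ m (φ Λ) _))) ⟩
    2 ^ (n + suc Λ) * (∑ m (𝟙 ∘ φ Λ) + S Λ) + 2 ^ m + 2 ^ m
      ≡⟨ cong (λ e → 2 ^ e * (∑ m (𝟙 ∘ φ Λ) + S Λ) + 2 ^ m + 2 ^ m) (+-suc n Λ) ⟩
    2 * 2 ^ (n + Λ) * (∑ m (𝟙 ∘ φ Λ) + S Λ) + 2 ^ m + 2 ^ m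
      ≡⟨ expand (2 ^ (n + Λ)) (∑ m (𝟙 ∘ φ Λ)) (S Λ) (2 ^ m) ⟩
    2 * (2 ^ (n + Λ) * S Λ + 2 ^ m) + 2 * 2 ^ (n + Λ) * ∑ m (𝟙 ∘ φ Λ)
      ≤⟨ +-mono-≤ (*-monoʳ-≤ 2 (geometric Λ)) (small Λ) ⟩
    2 * (2 ^ Λ * 2 ^ m) + 2 ^ m
      ≡⟨ collect (2 ^ Λ) (2 ^ m) ⟩
    2 ^ suc Λ * 2 ^ m + 2 ^ m ∎)

/-≤ : ∀ k a b .{{_ : NonZero a}} .{{_ : NonZero b}} → k * b ≤ a →
  ℤ.+ k ℚᵘ./ a ℚᵘ.≤ ℤ.+ 1 ℚᵘ./ b
/-≤ k (suc a) (suc b) le = ℚᵘ.*≤* (subst₂ ℤ._≤_ (ℤ.pos-* k (suc b)) (ℤ.pos-* 1 (suc a))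
  (ℤ.+≤+ (subst (k * suc b ≤_) (sym (*-identityˡ (suc a))) le)))

length-≤-max : ∀ (L : List String) → All (λ s → length s ≤ max 0 (List.map length L)) L
length-≤-max L = All.map⁻ {f = length} (xs≤max 0 (List.map length L))

-- A computable sequence of clopen events with probabilities at most 2^-(k + 1), each decided by the
-- bits inside its window. In `small` the length m is arbitrary beyond the window, so that events
-- with different windows can be measured at one length. By `grows`, strings of bounded length are
-- concerned with only finitely many events.
record Test : Set where
  field
    event   : ℕ → Cantor → Bool
    window  : ℕ → ℕ
    local   : ∀ k → DependsOn (event k) (_< window k)
    grows   : ∀ k → k ≤ window k
    small   : ∀ k m → window k ≤ m → 2 ^ suc k * ∑ m (𝟙 ∘ event k) ≤ 2 ^ m
    decider : Pred 2
    sound   : ∀ k s → holds decider (k ∷ index s ∷ []) ≡ true →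
              length s ≡ window k × event k (pad s) ≡ true
    complete : ∀ k s → length s ≡ window k → event k (pad s) ≡ true →
              holds decider (k ∷ index s ∷ []) ≡ true

module _ (test : Test) where
  open Test test

  -- The offset l comes first, where `mu` searches.
  accepts : Pred 3
  accepts = mkPred (λ { (l ∷ n ∷ i ∷ []) → holds decider (n + l ∷ i ∷ []) })
    (comp (Pred.code decider) (Fun.code (var 1F ⊕ var {3} 0F) ∷ proj 2F ∷ []))
    (λ { v@(l ∷ n ∷ i ∷ []) →
      comp (Fun.correct (var 1F ⊕ var 0F) v ∷ proj 2F ∷ []) (Pred.correct decider _) })

  rejects : Fun 3
  rejects = indicator (neg accepts)

  -- Section n is the union of all events from n on, the tail of the Borel-Cantelli argument: the
  -- search halts on a string exactly when some offset l is accepted.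
  mlTest : Rec 2
  mlTest = mu (Fun.code rejects)

  enumerated⇒ : ∀ n s → s ∈W[ mlTest , n ] →
    ∃[ l ] length s ≡ window (n + l) × event (n + l) (pad s) ≡ true
  enumerated⇒ n s (l , mu value _) with holds decider (n + l ∷ index s ∷ []) in eq
    | deterministic value (Fun.correct rejects (l ∷ n ∷ index s ∷ []))
  ... | true  | _  = l , sound (n + l) s eq
  ... | false | ()

  ⇒enumerated : ∀ n l s → length s ≡ window (n + l) → event (n + l) (pad s) ≡ true →
    s ∈W[ mlTest , n ]
  ⇒enumerated n l s len ev = mu-defined rejects (n ∷ index s ∷ []) l
    (cong (λ b → 𝟙 (not b)) (complete (n + l) s len ev))

  isMLTest : IsMLTest mlTest
  isMLTest n L enumerated = /-≤ (length (filter P? (strings m))) (2 ^ m) (2 ^ n)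
    {{m^n≢0 2 m}} {{m^n≢0 2 n}} (begin
      length (filter P? (strings m)) * 2 ^ n ≤⟨ *-monoˡ-≤ (2 ^ n) (filter-strings-≤ m P? _ covered) ⟩
      ∑ m (λ z → 𝟙 (anyBelow (suc m) (λ l → guarded l z))) * 2 ^ n ≡⟨ *-comm _ (2 ^ n) ⟩
      2 ^ n * ∑ m (λ z → 𝟙 (anyBelow (suc m) (λ l → guarded l z))) ≤⟨ ∑-anyBelow m n guarded guarded-small (suc m) ⟩
      2 ^ m ∎)
    where
    open ≤-Reasoning
    m : ℕ
    m = max 0 (List.map length L)

    P? : Decidable (λ t → Any (λ s → Prefix _≡_ s t) L)
    P? t = any? (λ s → prefix? Bool._≟_ s t) L

    -- An event whose window exceeds m cannot be measured by strings of length m; it contains no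
    -- string of `L` and is replaced by the empty event.
    guarded : ℕ → Cantor → Bool
    guarded l z = (window (n + l) ≤ᵇ m) ∧ event (n + l) z

    guarded-small : ∀ l → 2 ^ suc (n + l) * ∑ m (𝟙 ∘ guarded l) ≤ 2 ^ m
    guarded-small l with window (n + l) ≤ᵇ m in eq
    ... | true  = small (n + l) m (≤ᵇ-sound (window (n + l)) eq)
    ... | false = subst (_≤ 2 ^ m)
      (sym (trans (cong (2 ^ suc (n + l) *_) (∑-zero m)) (*-zeroʳ (2 ^ suc (n + l))))) z≤n

    covered : ∀ t → Any (λ s → Prefix _≡_ s t) L →
      anyBelow (suc m) (λ l → guarded l (pad t)) ≡ true
    covered t = go enumerated (length-≤-max L)
      where
      go : ∀ {L′ : List String} → All (_∈W[ mlTest , n ]) L′ → All (λ s → length s ≤ m) L′ →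
        Any (λ s → Prefix _≡_ s t) L′ → anyBelow (suc m) (λ l → guarded l (pad t)) ≡ true
      go (_ ∷ ws) (_ ∷ ls) (there p) = go ws ls p
      go {s List.∷ _} (w ∷ _) (len≤m ∷ _) (here s≼t) with enumerated⇒ n s w
      ... | l , len , ev = anyBelow-intro (s≤s l≤m) (∧-intro (≤ᵇ-true window≤m)
          (trans (sym (local (n + l) _ _ (λ i i<h → pad-prefix s≼t i (subst (i <_) (sym len) i<h)))) ev))
        where
        window≤m : window (n + l) ≤ m
        window≤m = subst (_≤ m) len len≤m
        -- Here `grows` bounds the offset, so the first m + 1 events suffice.
        l≤m : l ≤ m
        l≤m = ≤-trans (m≤n+m l n) (≤-trans (grows (n + l)) window≤m)

  -- Borel-Cantelli for a random sequence. Only the double negation of "from some n on no event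
  -- occurs" is obtained, which is enough for refuting injectivity.
  random-avoids : ∀ {x} → MLRandom x → ¬ (∀ n → ¬ (∀ l → event (n + l) x ≡ false))
  random-avoids {x} random hits = random mlTest isMLTest
    (λ n x∉U → hits n (λ l → not-true (λ ev → x∉U
      ( x ↾ window (n + l)
      , ⇒enumerated n l (x ↾ window (n + l)) (length-applyUpTo x (window (n + l)))
          (trans (local (n + l) _ _ (pad-↾ x (window (n + l)))) ev)
      , cong (x ↾_) (length-applyUpTo x (window (n + l)))))))

-- The binary tree of positive integers

≫-+ : ∀ n a b → n ≫ (a + b) ≡ (n ≫ b) ≫ a
≫-+ n zero    b = refl
≫-+ n (suc a) b = cong ⌊_/2⌋ (≫-+ n a b)

half-double : ∀ n → ⌊ n + n /2⌋ ≡ n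
half-double n = sym (n≡⌊n+n/2⌋ n)

half-double+1 : ∀ n → ⌊ suc (n + n) /2⌋ ≡ n
half-double+1 n = sym (n≡⌈n+n/2⌉ n)

half-cases : ∀ n → n ≡ ⌊ n /2⌋ + ⌊ n /2⌋ ⊎ n ≡ suc (⌊ n /2⌋ + ⌊ n /2⌋)
half-cases zero          = inj₁ refl
half-cases (suc zero)    = inj₂ refl
half-cases (suc (suc n)) with half-cases n
... | inj₁ eq = inj₁ (cong suc (trans (cong suc eq) (sym (+-suc ⌊ n /2⌋ ⌊ n /2⌋))))
... | inj₂ eq = inj₂ (cong (suc ∘ suc) (trans eq (sym (+-suc ⌊ n /2⌋ ⌊ n /2⌋))))

double≢double+1 : ∀ m n → m + m ≢ suc (n + n)
double≢double+1 m n eq = contradiction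
  (trans (sym (cong parity-of eq)) (even-double m))
  (λ odd → contradiction (trans (sym odd) (odd-double n)) λ ())
  where
  parity-of : ℕ → Bool
  parity-of zero    = false
  parity-of (suc n) = not (parity-of n)
  even-double : ∀ n → parity-of (n + n) ≡ false
  even-double zero = refl
  even-double (suc n) rewrite +-suc n n | even-double n = refl
  odd-double : ∀ n → parity-of (suc (n + n)) ≡ true
  odd-double n = cong not (even-double n)

-- The binary digits of v are 1 followed by l further digits.
Level : ℕ → ℕ → Set
Level l v = v ≫ l ≡ 1

≫-half : ∀ n l → n ≫ suc l ≡ ⌊ n /2⌋ ≫ l
≫-half n l = trans (cong (n ≫_) (+-comm 1 l)) (≫-+ n l 1)

level-child : ∀ l {v} c → ⌊ c /2⌋ ≡ v → Level l v → Level (suc l) c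
level-child l c refl lv = trans (≫-half c l) lv

level-double : ∀ l v → Level l v → Level (suc l) (v + v)
level-double l v = level-child l (v + v) (half-double v)

level-double+1 : ∀ l v → Level l v → Level (suc l) (suc (v + v))
level-double+1 l v = level-child l (suc (v + v)) (half-double+1 v)

0≫ : ∀ d → 0 ≫ d ≡ 0
0≫ zero    = refl
0≫ (suc d) = cong ⌊_/2⌋ (0≫ d)

1≫suc : ∀ d → 1 ≫ suc d ≡ 0
1≫suc d = trans (≫-half 1 d) (0≫ d)

above-root : ∀ {c l l′} → Level l c → l < l′ → c ≫ l′ ≡ 0
above-root {c} {l} p (s≤s {n = k} l≤k) = begin
  c ≫ suc k               ≡⟨ cong (λ e → c ≫ suc e) (m∸n+n≡m l≤k) ⟨
  c ≫ (suc (k ∸ l) + l)   ≡⟨ ≫-+ c (suc (k ∸ l)) l ⟩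
  (c ≫ l) ≫ suc (k ∸ l)   ≡⟨ cong (_≫ suc (k ∸ l)) p ⟩
  1 ≫ suc (k ∸ l)         ≡⟨ 1≫suc (k ∸ l) ⟩
  0                       ∎
  where open ≡-Reasoning

level-unique : ∀ {c l l′} → Level l c → Level l′ c → l ≡ l′
level-unique {c} {l} {l′} p q with <-cmp l l′
... | tri≈ _ eq _   = eq
... | tri< l<l′ _ _ = contradiction (trans (sym q) (above-root {c} p l<l′)) λ ()
... | tri> _ _ l′<l = contradiction (trans (sym p) (above-root {c} q l′<l)) λ ()

-- The node c lies at level l + δ and at level l + δ′, and levels are unique.
ancestor-unique : ∀ {c l x y} δ δ′ → Level l x → Level l y → c ≫ δ ≡ x → c ≫ δ′ ≡ y → δ ≡ δ′ × x ≡ y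
ancestor-unique {c} {l} δ δ′ lx ly refl refl =
  δ≡δ′ , cong (c ≫_) δ≡δ′
  where
  δ≡δ′ : δ ≡ δ′
  δ≡δ′ = +-cancelˡ-≡ l δ δ′ (level-unique {c} (trans (≫-+ c l δ) lx) (trans (≫-+ c l δ′) ly))

half<⇒< : ∀ n {b} → ⌊ n /2⌋ < b → n < 2 * b
half<⇒< n {b} half<b = ≤-trans (s≤s upper) (subst (suc (suc (h + h)) ≤_) (cong (b +_) (sym (+-identityʳ b)))
  (≤-trans (≤-reflexive (cong suc (sym (+-suc h h)))) (+-mono-≤ half<b half<b)))
  where
  h : ℕ
  h = ⌊ n /2⌋
  upper : n ≤ suc (h + h)
  upper = [ (λ eq → ≤-trans (≤-reflexive eq) (n≤1+n _)) , ≤-reflexive ]′ (half-cases n)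

level-bound : ∀ l {v} → Level l v → v < 2 ^ suc l
level-bound zero        refl = s≤s (s≤s z≤n)
level-bound (suc l) {v} lv   = half<⇒< v (level-bound l (trans (sym (≫-half v l)) lv))

-- Matched pairs

same : Bool → Bool → Bool
same a b = (a ∧ b) ∨ (not a ∧ not b)

-- The a's label the two children of the first node and the b's those of the second. The e's tell
-- whether the pairs (2v, 2w), (2v + 1, 2w + 1) and (2v, 2w + 1) are extinct; the final `true` is
-- the case without offspring.
deadStep : (e₀ e₁ e₂ a₀ a₁ b₀ b₁ : Bool) → Bool
deadStep e₀ e₁ e₂ a₀ a₁ b₀ b₁ =
  if same a₀ b₀
  then (if same a₁ b₁ then e₀ ∧ e₁ else e₀)
  else (if same a₁ b₁ then e₁ else (if same a₀ b₁ then e₂ else true))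

dead : ℕ → ℕ → ℕ → Cantor → Bool
dead zero    v w z = false
dead (suc d) v w z = deadStep
  (dead d (v + v) (w + w) z) (dead d (suc (v + v)) (suc (w + w)) z) (dead d (v + v) (suc (w + w)) z)
  (z (v + v)) (z (suc (v + v))) (z (w + w)) (z (suc (w + w)))

-- Proper descendants only: extinction does not consult the labels of v and w themselves, which
-- keeps the labels of a pair independent of its fate.
Under : ℕ → ℕ → ℕ → ℕ → Set
Under d v w c = ∃[ δ ] δ < d × (c ≫ suc δ ≡ v ⊎ c ≫ suc δ ≡ w)

under? : ∀ d v w c → Dec (Under d v w c)
under? d v w c = anyUpTo? (λ δ → (c ≫ suc δ ≟ v) ⊎-dec (c ≫ suc δ ≟ w)) d

under-child : ∀ {d v w v′ w′ c} → ⌊ v′ /2⌋ ≡ v → ⌊ w′ /2⌋ ≡ w → Under d v′ w′ c → Under (suc d) v w c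
under-child refl refl (δ , δ<d , inj₁ refl) = suc δ , s≤s δ<d , inj₁ refl
under-child refl refl (δ , δ<d , inj₂ refl) = suc δ , s≤s δ<d , inj₂ refl

cong₇ : ∀ {A B : Set} (f : A → A → A → A → A → A → A → B) {a a′ b b′ c c′ d d′ e e′ g g′ h h′} →
  a ≡ a′ → b ≡ b′ → c ≡ c′ → d ≡ d′ → e ≡ e′ → g ≡ g′ → h ≡ h′ → f a b c d e g h ≡ f a′ b′ c′ d′ e′ g′ h′
cong₇ f refl refl refl refl refl refl refl = refl

dead-local : ∀ d v w → DependsOn (dead d v w) (Under d v w)
dead-local zero    v w z z′ eq = refl
dead-local (suc d) v w z z′ eq = cong₇ deadStep
  (dead-local d _ _ z z′ (λ n u → eq n (under-child (half-double v) (half-double w) u)))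
  (dead-local d _ _ z z′ (λ n u → eq n (under-child (half-double+1 v) (half-double+1 w) u)))
  (dead-local d _ _ z z′ (λ n u → eq n (under-child (half-double v) (half-double+1 w) u)))
  (eq _ (0 , s≤s z≤n , inj₁ (half-double v))) (eq _ (0 , s≤s z≤n , inj₁ (half-double+1 v)))
  (eq _ (0 , s≤s z≤n , inj₂ (half-double w))) (eq _ (0 , s≤s z≤n , inj₂ (half-double+1 w)))

deadStep-mono : ∀ {e₀ e₁ e₂ e₀′ e₁′ e₂′} a₀ a₁ b₀ b₁ →
  (e₀ ≡ true → e₀′ ≡ true) → (e₁ ≡ true → e₁′ ≡ true) → (e₂ ≡ true → e₂′ ≡ true) →
  deadStep e₀ e₁ e₂ a₀ a₁ b₀ b₁ ≡ true → deadStep e₀′ e₁′ e₂′ a₀ a₁ b₀ b₁ ≡ true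
deadStep-mono a₀ a₁ b₀ b₁ m₀ m₁ m₂ eq with same a₀ b₀ | same a₁ b₁ | same a₀ b₁
... | true  | true  | _     = let p , q = ∧-elim eq in ∧-intro (m₀ p) (m₁ q)
... | true  | false | _     = m₀ eq
... | false | true  | _     = m₁ eq
... | false | false | true  = m₂ eq
... | false | false | false = refl

dead-mono : ∀ {d d′} → d ≤ d′ → ∀ v w z → dead d v w z ≡ true → dead d′ v w z ≡ true
dead-mono (s≤s d≤d′) v w z = deadStep-mono (z (v + v)) (z (suc (v + v))) (z (w + w)) (z (suc (w + w)))
  (dead-mono d≤d′ _ _ z) (dead-mono d≤d′ _ _ z) (dead-mono d≤d′ _ _ z)

-- Extinction probabilities

∑ᵇ : (Bool → ℕ) → ℕ
∑ᵇ h = h false + h true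

fresh₂ : ∀ m {i j} → i < m → j < m → j ≢ i → (F : Bool → Bool → Cantor → ℕ) →
  (∀ a b → DependsOn (F a b) (λ n → n ≢ i × n ≢ j)) →
  4 * ∑ m (λ z → F (z i) (z j) z) ≡ ∑ᵇ λ a → ∑ᵇ λ b → ∑ m (F a b)
fresh₂ m {i} {j} i<m j<m j≢i F dep = begin
  4 * ∑ m (λ z → F (z i) (z j) z)
    ≡⟨ *-assoc 2 2 (∑ m (λ z → F (z i) (z j) z)) ⟩
  2 * (2 * ∑ m (λ z → F (z i) (z j) z))
    ≡⟨ cong (2 *_) (∑-fresh m i<m (λ a z → F a (z j) z)
         (λ a z z′ eq → trans (cong (λ b → F a b z) (eq j j≢i)) (dep a (z′ j) z z′ (λ n p → eq n (proj₁ p))))) ⟩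
  2 * ∑ᵇ (λ a → ∑ m (λ z → F a (z j) z))
    ≡⟨ *-distribˡ-+ 2 (∑ m (λ z → F false (z j) z)) _ ⟩
  ∑ᵇ (λ a → 2 * ∑ m (λ z → F a (z j) z))
    ≡⟨ cong₂ _+_ (inner false) (inner true) ⟩
  (∑ᵇ λ a → ∑ᵇ λ b → ∑ m (F a b)) ∎
  where
  open ≡-Reasoning
  inner : ∀ a → 2 * ∑ m (λ z → F a (z j) z) ≡ ∑ᵇ λ b → ∑ m (F a b)
  inner a = ∑-fresh m j<m (F a) (λ b → dependsOn-mono proj₂ (dep a b))

fresh₄ : ∀ m {i j k l} → i < m → j < m → k < m → l < m →
  j ≢ i → l ≢ k → k ≢ i → k ≢ j → l ≢ i → l ≢ j → (F : Bool → Bool → Bool → Bool → Cantor → ℕ) →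
  (∀ a b c d → DependsOn (F a b c d) (λ n → (n ≢ i × n ≢ j) × (n ≢ k × n ≢ l))) →
  16 * ∑ m (λ z → F (z i) (z j) (z k) (z l) z) ≡ ∑ᵇ λ a → ∑ᵇ λ b → ∑ᵇ λ c → ∑ᵇ λ d → ∑ m (F a b c d)
fresh₄ m {i} {j} {k} {l} i<m j<m k<m l<m j≢i l≢k k≢i k≢j l≢i l≢j F dep = begin
  16 * X ≡⟨ *-assoc 4 4 X ⟩
  4 * (4 * X)
    ≡⟨ cong (4 *_) (fresh₂ m i<m j<m j≢i (λ a b z → F a b (z k) (z l) z) outer-local) ⟩
  4 * (∑ᵇ λ a → ∑ᵇ λ b → Y a b)
    ≡⟨ distrib (Y false false) (Y false true) (Y true false) (Y true true) ⟩
  (∑ᵇ λ a → ∑ᵇ λ b → 4 * Y a b)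
    ≡⟨ cong₂ _+_ (cong₂ _+_ (inner false false) (inner false true))
                 (cong₂ _+_ (inner true false) (inner true true)) ⟩
  (∑ᵇ λ a → ∑ᵇ λ b → ∑ᵇ λ c → ∑ᵇ λ d → ∑ m (F a b c d)) ∎
  where
  open ≡-Reasoning
  X : ℕ
  X = ∑ m (λ z → F (z i) (z j) (z k) (z l) z)

  Y : Bool → Bool → ℕ
  Y a b = ∑ m (λ z → F a b (z k) (z l) z)

  distrib : ∀ p q r s → 4 * (p + q + (r + s)) ≡ 4 * p + 4 * q + (4 * r + 4 * s)
  distrib = solve-∀

  outer-local : ∀ a b → DependsOn (λ z → F a b (z k) (z l) z) (λ n → n ≢ i × n ≢ j)
  outer-local a b z z′ eq = trans
    (cong₂ (λ c d → F a b c d z) (eq k (k≢i , k≢j)) (eq l (l≢i , l≢j)))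
    (dep a b (z′ k) (z′ l) z z′ (λ n p → eq n (proj₁ p)))

  inner : ∀ a b → 4 * Y a b ≡ ∑ᵇ λ c → ∑ᵇ λ d → ∑ m (F a b c d)
  inner a b = fresh₂ m k<m l<m l≢k (F a b) (λ c d → dependsOn-mono proj₂ (dep a b c d))

under-fresh : ∀ l {d v w c} → Level l v → Level l w → Level l c → ¬ Under d v w c
under-fresh l {c = c} lv lw lc (δ , _ , inj₁ eq) =
  contradiction (proj₁ (ancestor-unique {c} {l} 0 (suc δ) lc lv refl eq)) λ ()
under-fresh l {c = c} lv lw lc (δ , _ , inj₂ eq) =
  contradiction (proj₁ (ancestor-unique {c} {l} 0 (suc δ) lc lw refl eq)) λ ()

-- A common descendant would have two different ancestors at level l.
under-disjoint : ∀ l {d d′ v w v′ w′ c} → Level l v → Level l w → Level l v′ → Level l w′ →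
  v ≢ v′ → v ≢ w′ → w ≢ v′ → w ≢ w′ → Under d v w c → ¬ Under d′ v′ w′ c
under-disjoint l {c = c} lv lw lv′ lw′ n₁ n₂ n₃ n₄ (δ , _ , p) (δ′ , _ , p′) with p | p′
... | inj₁ e | inj₁ e′ = n₁ (proj₂ (ancestor-unique {c} {l} (suc δ) (suc δ′) lv lv′ e e′))
... | inj₁ e | inj₂ e′ = n₂ (proj₂ (ancestor-unique {c} {l} (suc δ) (suc δ′) lv lw′ e e′))
... | inj₂ e | inj₁ e′ = n₃ (proj₂ (ancestor-unique {c} {l} (suc δ) (suc δ′) lw lv′ e e′))
... | inj₂ e | inj₂ e′ = n₄ (proj₂ (ancestor-unique {c} {l} (suc δ) (suc δ′) lw lw′ e e′))

extinction : ℕ → ℕ → ℕ → ℕ → ℕ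
extinction m d v w = ∑ m (𝟙 ∘ dead d v w)

double-injective : ∀ v w → v + v ≡ w + w → v ≡ w
double-injective v w eq = trans (sym (half-double v)) (trans (cong ⌊_/2⌋ eq) (half-double w))

-- Counts the 16 labellings of the four children: 4 give both parallel pairs, 4 only the first, 4
-- only the second, 2 the crossed pair, and 2 no offspring. The two parallel pairs have disjoint
-- subtrees, so their joint extinction is a product.
extinction-step : ∀ m d l {v w} → Level l v → Level l w → v ≢ w →
  suc (v + v) < m → suc (w + w) < m →
  let e₀ = extinction m d (v + v) (w + w)
      e₁ = extinction m d (suc (v + v)) (suc (w + w))
      e₂ = extinction m d (v + v) (suc (w + w))
      M  = 2 ^ m
  in 16 * (M * extinction m (suc d) v w) ≡ 4 * (e₀ * e₁) + 4 * (M * e₀) + 4 * (M * e₁) + 2 * (M * e₂) + 2 * (M * M)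
extinction-step m d l {v} {w} lv lw v≢w v₁<m w₁<m = begin
  16 * (M * extinction m (suc d) v w)
    ≡⟨ rotate M (extinction m (suc d) v w) ⟩
  M * (16 * extinction m (suc d) v w)
    ≡⟨ cong (M *_) (fresh₄ m (<-trans ≤-refl v₁<m) v₁<m (<-trans ≤-refl w₁<m) w₁<m
         (λ eq → double≢double+1 v v (sym eq)) (λ eq → double≢double+1 w w (sym eq))
         (λ eq → v≢w (double-injective v w (sym eq))) (double≢double+1 w v)
         (λ eq → double≢double+1 v w (sym eq)) (λ eq → v≢w (double-injective v w (suc-injective (sym eq))))
         F F-local) ⟩
  M * (∑ᵇ λ a → ∑ᵇ λ b → ∑ᵇ λ c → ∑ᵇ λ d → ∑ m (F a b c d))
    ≡⟨ cong (M *_) (collect both e₀ e₁ e₂ (∑ m (λ _ → 1))) ⟩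
  M * (4 * both + 4 * e₀ + 4 * e₁ + 2 * e₂ + 2 * ∑ m (λ _ → 1))
    ≡⟨ cong (λ t → M * (4 * both + 4 * e₀ + 4 * e₁ + 2 * e₂ + 2 * t)) (∑-one m) ⟩
  M * (4 * both + 4 * e₀ + 4 * e₁ + 2 * e₂ + 2 * M)
    ≡⟨ expand M both e₀ e₁ e₂ ⟩
  4 * (M * both) + 4 * (M * e₀) + 4 * (M * e₁) + 2 * (M * e₂) + 2 * (M * M)
    ≡⟨ cong (λ q → 4 * q + 4 * (M * e₀) + 4 * (M * e₁) + 2 * (M * e₂) + 2 * (M * M)) both-product ⟩
  4 * (e₀ * e₁) + 4 * (M * e₀) + 4 * (M * e₁) + 2 * (M * e₂) + 2 * (M * M) ∎
  where
  open ≡-Reasoning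
  v₀ v₁ w₀ w₁ M e₀ e₁ e₂ both : ℕ
  v₀ = v + v
  v₁ = suc (v + v)
  w₀ = w + w
  w₁ = suc (w + w)
  M  = 2 ^ m
  e₀ = extinction m d v₀ w₀
  e₁ = extinction m d v₁ w₁
  e₂ = extinction m d v₀ w₁
  both = ∑ m (λ z → 𝟙 (dead d v₀ w₀ z ∧ dead d v₁ w₁ z))

  lv₀ : Level (suc l) v₀
  lv₀ = level-double l v lv
  lv₁ : Level (suc l) v₁
  lv₁ = level-double+1 l v lv
  lw₀ : Level (suc l) w₀
  lw₀ = level-double l w lw
  lw₁ : Level (suc l) w₁
  lw₁ = level-double+1 l w lw

  F : Bool → Bool → Bool → Bool → Cantor → ℕ
  F a₀ a₁ b₀ b₁ z = 𝟙 (deadStep (dead d v₀ w₀ z) (dead d v₁ w₁ z) (dead d v₀ w₁ z) a₀ a₁ b₀ b₁)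

  off-children : ∀ {p q n} → Level (suc l) p → Level (suc l) q → Under d p q n →
    (n ≢ v₀ × n ≢ v₁) × (n ≢ w₀ × n ≢ w₁)
  off-children lp lq u =
    ( (λ { refl → under-fresh (suc l) lp lq lv₀ u }) , (λ { refl → under-fresh (suc l) lp lq lv₁ u }))
    , (λ { refl → under-fresh (suc l) lp lq lw₀ u }) , (λ { refl → under-fresh (suc l) lp lq lw₁ u })

  F-local : ∀ a₀ a₁ b₀ b₁ → DependsOn (F a₀ a₁ b₀ b₁) (λ n → (n ≢ v₀ × n ≢ v₁) × (n ≢ w₀ × n ≢ w₁))
  F-local a₀ a₁ b₀ b₁ z z′ eq = cong 𝟙 (cong₇ deadStep
    (dead-local d v₀ w₀ z z′ (λ n u → eq n (off-children lv₀ lw₀ u)))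
    (dead-local d v₁ w₁ z z′ (λ n u → eq n (off-children lv₁ lw₁ u)))
    (dead-local d v₀ w₁ z z′ (λ n u → eq n (off-children lv₀ lw₁ u)))
    (refl {x = a₀}) (refl {x = a₁}) (refl {x = b₀}) (refl {x = b₁}))

  both-product : M * both ≡ e₀ * e₁
  both-product = trans
    (cong (M *_) (∑-cong m (λ z → 𝟙-∧ (dead d v₀ w₀ z) (dead d v₁ w₁ z))))
    (independent m (under? d v₀ w₀)
      (λ z z′ eq → cong 𝟙 (dead-local d v₀ w₀ z z′ eq))
      (λ z z′ eq → cong 𝟙 (dead-local d v₁ w₁ z z′ (λ n u → eq n (λ u′ →
        under-disjoint (suc l) {d} {d} {v₀} {w₀} {v₁} {w₁} {n} lv₀ lw₀ lv₁ lw₁ (double≢double+1 v v) (double≢double+1 v w)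
          (double≢double+1 w v) (double≢double+1 w w) u′ u)))))

  rotate : ∀ M e → 16 * (M * e) ≡ M * (16 * e)
  rotate = solve-∀

  collect : ∀ q e₀ e₁ e₂ t →
    (((q + e₀) + (e₁ + t)) + ((e₀ + q) + (e₂ + e₁))) + (((e₁ + e₂) + (q + e₀)) + ((t + e₁) + (e₀ + q)))
    ≡ 4 * q + 4 * e₀ + 4 * e₁ + 2 * e₂ + 2 * t
  collect = solve-∀

  expand : ∀ M q e₀ e₁ e₂ → M * (4 * q + 4 * e₀ + 4 * e₁ + 2 * e₂ + 2 * M) ≡
    4 * (M * q) + 4 * (M * e₀) + 4 * (M * e₁) + 2 * (M * e₂) + 2 * (M * M)
  expand = solve-∀

-- With h = M - 2e, the distance from the fixed point 1/2, the recursion becomes 8Mh + h₀h₁ = M(3h₀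
-- + 3h₁ + h₂). Dropping h₀h₁ leaves a linear contraction with factor 7/8.
deficit-step : ∀ M .{{_ : NonZero M}} e e₀ e₁ e₂ h₀ h₁ h₂ →
  16 * (M * e) ≡ 4 * (e₀ * e₁) + 4 * (M * e₀) + 4 * (M * e₁) + 2 * (M * e₂) + 2 * (M * M) →
  2 * e₀ + h₀ ≡ M → 2 * e₁ + h₁ ≡ M → 2 * e₂ + h₂ ≡ M →
  ∃[ h ] 2 * e + h ≡ M × 8 * h ≤ 3 * h₀ + 3 * h₁ + h₂
deficit-step M e e₀ e₁ e₂ h₀ h₁ h₂ step eq₀ eq₁ eq₂ =
  h , m+[n∸m]≡n 2e≤M , *-cancelˡ-≤ M (begin
    M * (8 * h)                       ≤⟨ m≤m+n _ _ ⟩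
    M * (8 * h) + h₀ * h₁             ≡⟨ +-cancelˡ-≡ (16 * (M * e)) _ _ (sym balance) ⟩
    M * (3 * h₀ + 3 * h₁ + h₂)        ∎)
  where
  open ≤-Reasoning

  f≤M : ∀ a b → 2 * a + b ≡ M → 2 * a ≤ M
  f≤M a b eq = subst (2 * a ≤_) eq (m≤m+n (2 * a) b)

  double-factors : ∀ M e₀ e₁ e₂ →
    4 * (e₀ * e₁) + 4 * (M * e₀) + 4 * (M * e₁) + 2 * (M * e₂) + 2 * (M * M)
    ≡ 2 * e₀ * (2 * e₁) + 2 * (M * (2 * e₀)) + 2 * (M * (2 * e₁)) + M * (2 * e₂) + 2 * (M * M)
  double-factors = solve-∀

  eight : ∀ M → M * M + 2 * (M * M) + 2 * (M * M) + M * M + 2 * (M * M) ≡ 8 * M * M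
  eight = solve-∀

  regroup : ∀ M e → 8 * M * (2 * e) ≡ 16 * (M * e)
  regroup = solve-∀

  2e≤M : 2 * e ≤ M
  2e≤M = *-cancelˡ-≤ (8 * M) {{m*n≢0 8 M}} (begin
    8 * M * (2 * e) ≡⟨ trans (regroup M e) (trans step (double-factors M e₀ e₁ e₂)) ⟩
    2 * e₀ * (2 * e₁) + 2 * (M * (2 * e₀)) + 2 * (M * (2 * e₁)) + M * (2 * e₂) + 2 * (M * M)
      ≤⟨ +-monoˡ-≤ (2 * (M * M)) (+-mono-≤ (+-mono-≤ (+-mono-≤
           (*-mono-≤ (f≤M e₀ h₀ eq₀) (f≤M e₁ h₁ eq₁))
           (*-monoʳ-≤ 2 (*-monoʳ-≤ M (f≤M e₀ h₀ eq₀))))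
           (*-monoʳ-≤ 2 (*-monoʳ-≤ M (f≤M e₁ h₁ eq₁))))
           (*-monoʳ-≤ M (f≤M e₂ h₂ eq₂))) ⟩
    M * M + 2 * (M * M) + 2 * (M * M) + M * M + 2 * (M * M) ≡⟨ eight M ⟩
    8 * M * M ∎)

  h : ℕ
  h = M ∸ 2 * e

  pair-up : ∀ M e₀ e₁ e₂ h₀ h₁ h₂ →
    4 * (e₀ * e₁) + 4 * (M * e₀) + 4 * (M * e₁) + 2 * (M * e₂) + 2 * (M * M) + M * (3 * h₀ + 3 * h₁ + h₂)
    ≡ (4 * (e₀ * e₁) + M * h₀ + M * h₁) + 2 * (M * (2 * e₀ + h₀)) + 2 * (M * (2 * e₁ + h₁))
      + M * (2 * e₂ + h₂) + 2 * (M * M)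
  pair-up = solve-∀

  product : ∀ e₀ e₁ h₀ h₁ →
    4 * (e₀ * e₁) + (2 * e₁ + h₁) * h₀ + (2 * e₀ + h₀) * h₁ ≡ (2 * e₀ + h₀) * (2 * e₁ + h₁) + h₀ * h₁
  product = solve-∀

  square : 4 * (e₀ * e₁) + M * h₀ + M * h₁ ≡ M * M + h₀ * h₁
  square = trans (cong₂ (λ a b → 4 * (e₀ * e₁) + a * h₀ + b * h₁) (sym eq₁) (sym eq₀))
    (trans (product e₀ e₁ h₀ h₁) (cong₂ (λ a b → a * b + h₀ * h₁) eq₀ eq₁))

  finish : ∀ M p → M * M + p + 2 * (M * M) + 2 * (M * M) + M * M + 2 * (M * M) ≡ 8 * (M * M) + p
  finish = solve-∀

  unfold : ∀ M e h p → 8 * (M * (2 * e + h)) + p ≡ 16 * (M * e) + (M * (8 * h) + p)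
  unfold = solve-∀

  balance : 16 * (M * e) + M * (3 * h₀ + 3 * h₁ + h₂) ≡ 16 * (M * e) + (M * (8 * h) + h₀ * h₁)
  balance = begin-equality
    16 * (M * e) + M * (3 * h₀ + 3 * h₁ + h₂)
      ≡⟨ cong (_+ M * (3 * h₀ + 3 * h₁ + h₂)) step ⟩
    4 * (e₀ * e₁) + 4 * (M * e₀) + 4 * (M * e₁) + 2 * (M * e₂) + 2 * (M * M) + M * (3 * h₀ + 3 * h₁ + h₂)
      ≡⟨ pair-up M e₀ e₁ e₂ h₀ h₁ h₂ ⟩
    (4 * (e₀ * e₁) + M * h₀ + M * h₁) + 2 * (M * (2 * e₀ + h₀)) + 2 * (M * (2 * e₁ + h₁))
      + M * (2 * e₂ + h₂) + 2 * (M * M)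
      ≡⟨ cong₂ (λ s a → s + 2 * (M * a) + 2 * (M * (2 * e₁ + h₁)) + M * (2 * e₂ + h₂) + 2 * (M * M)) square eq₀ ⟩
    M * M + h₀ * h₁ + 2 * (M * M) + 2 * (M * (2 * e₁ + h₁)) + M * (2 * e₂ + h₂) + 2 * (M * M)
      ≡⟨ cong₂ (λ a b → M * M + h₀ * h₁ + 2 * (M * M) + 2 * (M * a) + M * b + 2 * (M * M)) eq₁ eq₂ ⟩
    M * M + h₀ * h₁ + 2 * (M * M) + 2 * (M * M) + M * M + 2 * (M * M)
      ≡⟨ finish M (h₀ * h₁) ⟩
    8 * (M * M) + h₀ * h₁
      ≡⟨ cong (λ a → 8 * (M * a) + h₀ * h₁) (m+[n∸m]≡n 2e≤M) ⟨
    8 * (M * (2 * e + h)) + h₀ * h₁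
      ≡⟨ unfold M e h (h₀ * h₁) ⟩
    16 * (M * e) + (M * (8 * h) + h₀ * h₁) ∎

-- The hypotheses on m place every descendant down to depth d among the summed bits, since those of
-- v are below (v + 1) 2^d. The deficit is 1 at depth 0 and shrinks by 7/8 per generation.
extinction-deficit : ∀ m d l {v w} → Level l v → Level l w → v ≢ w →
  suc v * 2 ^ d ≤ m → suc w * 2 ^ d ≤ m →
  ∃[ h ] 2 * extinction m d v w + h ≡ 2 ^ m × 8 ^ d * h ≤ 7 ^ d * 2 ^ m
extinction-deficit m zero l _ _ _ _ _ = 2 ^ m , cong (λ e → 2 * e + 2 ^ m) (∑-zero m) , ≤-refl
extinction-deficit m (suc d) l {v} {w} lv lw v≢w v-fits w-fits =
  h , eq , bound
  where
  fits₁ : ∀ u → suc u * 2 ^ suc d ≤ m → suc (suc (u + u)) * 2 ^ d ≤ m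
  fits₁ u fits = subst (_≤ m) (lemma u (2 ^ d)) fits
    where
    lemma : ∀ u p → (1 + u) * (2 * p) ≡ (2 + (u + u)) * p
    lemma = solve-∀
  fits₀ : ∀ u → suc u * 2 ^ suc d ≤ m → suc (u + u) * 2 ^ d ≤ m
  fits₀ u fits = ≤-trans (*-monoˡ-≤ (2 ^ d) (n≤1+n (suc (u + u)))) (fits₁ u fits)
  inside : ∀ u → suc u * 2 ^ suc d ≤ m → suc (u + u) < m
  inside u fits = ≤-trans (m≤m*n (suc (suc (u + u))) (2 ^ d) {{m^n≢0 2 d}}) (fits₁ u fits)

  lv₀ : Level (suc l) (v + v)
  lv₀ = level-double l v lv
  lv₁ : Level (suc l) (suc (v + v))
  lv₁ = level-double+1 l v lv
  lw₀ : Level (suc l) (w + w)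
  lw₀ = level-double l w lw
  lw₁ : Level (suc l) (suc (w + w))
  lw₁ = level-double+1 l w lw

  ih₀ = extinction-deficit m d (suc l) lv₀ lw₀ (v≢w ∘ double-injective v w) (fits₀ v v-fits) (fits₀ w w-fits)
  ih₁ = extinction-deficit m d (suc l) lv₁ lw₁ (v≢w ∘ double-injective v w ∘ suc-injective) (fits₁ v v-fits) (fits₁ w w-fits)
  ih₂ = extinction-deficit m d (suc l) lv₀ lw₁ (double≢double+1 v w) (fits₀ v v-fits) (fits₁ w w-fits)

  next = deficit-step (2 ^ m) {{m^n≢0 2 m}} _
    (extinction m d (v + v) (w + w)) (extinction m d (suc (v + v)) (suc (w + w)))
    (extinction m d (v + v) (suc (w + w))) (proj₁ ih₀) (proj₁ ih₁) (proj₁ ih₂)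
    (extinction-step m d l lv lw v≢w (inside v v-fits) (inside w w-fits))
    (proj₁ (proj₂ ih₀)) (proj₁ (proj₂ ih₁)) (proj₁ (proj₂ ih₂))

  h : ℕ
  h = proj₁ next
  eq : 2 * extinction m (suc d) v w + h ≡ 2 ^ m
  eq = proj₁ (proj₂ next)

  bound : 8 ^ suc d * h ≤ 7 ^ suc d * 2 ^ m
  bound = begin
    8 ^ suc d * h ≡⟨ left (8 ^ d) h ⟩
    8 ^ d * (8 * h) ≤⟨ *-monoʳ-≤ (8 ^ d) (proj₂ (proj₂ next)) ⟩
    8 ^ d * (3 * h₀ + 3 * h₁ + h₂) ≡⟨ middle (8 ^ d) h₀ h₁ h₂ ⟩
    3 * (8 ^ d * h₀) + 3 * (8 ^ d * h₁) + 8 ^ d * h₂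
      ≤⟨ +-mono-≤ (+-mono-≤ (*-monoʳ-≤ 3 (proj₂ (proj₂ ih₀))) (*-monoʳ-≤ 3 (proj₂ (proj₂ ih₁)))) (proj₂ (proj₂ ih₂)) ⟩
    3 * (7 ^ d * 2 ^ m) + 3 * (7 ^ d * 2 ^ m) + 7 ^ d * 2 ^ m ≡⟨ right (7 ^ d) (2 ^ m) ⟩
    7 ^ suc d * 2 ^ m ∎
    where
    open ≤-Reasoning
    h₀ h₁ h₂ : ℕ
    h₀ = proj₁ ih₀
    h₁ = proj₁ ih₁
    h₂ = proj₁ ih₂
    left : ∀ a h → 8 * a * h ≡ a * (8 * h)
    left = solve-∀
    middle : ∀ a x y z → a * (3 * x + 3 * y + z) ≡ 3 * (a * x) + 3 * (a * y) + a * z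
    middle = solve-∀
    right : ∀ a M → 3 * (a * M) + 3 * (a * M) + a * M ≡ 7 * a * M
    right = solve-∀

-- Survival as the existence of a matched path

even : ℕ → Bool
even n = n ≡ᵇ ⌊ n /2⌋ + ⌊ n /2⌋

even-double : ∀ n → even (n + n) ≡ true
even-double n = ≡ᵇ-true (cong₂ _+_ (sym (half-double n)) (sym (half-double n)))

even-double+1 : ∀ n → even (suc (n + n)) ≡ false
even-double+1 n = not-true (λ eq → double≢double+1 n n (sym (trans (≡ᵇ-sound (suc (n + n)) eq)
  (cong₂ _+_ (half-double+1 n) (half-double+1 n)))))

-- Recognises offspring pairs from the children alone. For the crossed case p = 2v and q = 2w + 1,
-- `pred q` and `suc p` are their siblings, and both parallel matches must fail.
link : Cantor → ℕ → ℕ → Bool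
link z p q = same (z p) (z q) ∧ (same (even p) (even q)
  ∨ ((even p ∧ not (even q)) ∧ (not (same (z p) (z (pred q))) ∧ not (same (z (suc p)) (z q)))))

record Survivor (z : Cantor) (d v w : ℕ) : Set where
  constructor survivor
  field
    {left right} : ℕ
    left-child   : ⌊ left /2⌋ ≡ v
    right-child  : ⌊ right /2⌋ ≡ w
    linked       : link z left right ≡ true
    alive        : dead d left right z ≡ false

alive⇒survivor : ∀ d v w z → dead (suc d) v w z ≡ false → Survivor z d v w
alive⇒survivor d v w z eq
  with same (z (v + v)) (z (w + w)) in s₀ | same (z (suc (v + v))) (z (suc (w + w))) in s₁
     | same (z (v + v)) (z (suc (w + w))) in s₂
... | false | true  | _    = survivor (half-double+1 v) (half-double+1 w) link₁₁ eq
  where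
  link₁₁ : link z (suc (v + v)) (suc (w + w)) ≡ true
  link₁₁ rewrite s₁ | even-double+1 v | even-double+1 w = refl
... | true  | false | _    = survivor (half-double v) (half-double w) link₀₀ eq
  where
  link₀₀ : link z (v + v) (w + w) ≡ true
  link₀₀ rewrite s₀ | even-double v | even-double w = refl
... | false | false | true = survivor (half-double v) (half-double+1 w) link₀₁ eq
  where
  link₀₁ : link z (v + v) (suc (w + w)) ≡ true
  link₀₁ rewrite s₂ | even-double v | even-double+1 w | s₀ | s₁ = refl
-- Both parallel pairs arise. If the first is extinct, the conjunction in `deadStep` makes the
-- second survive.
... | true  | true  | _ with dead d (v + v) (w + w) z in e₀
...   | false = survivor (half-double v) (half-double w) link₀₀ e₀
  where
  link₀₀ : link z (v + v) (w + w) ≡ true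
  link₀₀ rewrite s₀ | even-double v | even-double w = refl
...   | true  = survivor (half-double+1 v) (half-double+1 w) link₁₁ eq
  where
  link₁₁ : link z (suc (v + v)) (suc (w + w)) ≡ true
  link₁₁ rewrite s₁ | even-double+1 v | even-double+1 w = refl

alive₀ : ∀ d v w z → same (z (v + v)) (z (w + w)) ≡ true → dead d (v + v) (w + w) z ≡ false →
  dead (suc d) v w z ≡ false
alive₀ d v w z s e rewrite s | e with same (z (suc (v + v))) (z (suc (w + w)))
... | true  = refl
... | false = refl

alive₁ : ∀ d v w z → same (z (suc (v + v))) (z (suc (w + w))) ≡ true →
  dead d (suc (v + v)) (suc (w + w)) z ≡ false → dead (suc d) v w z ≡ false
alive₁ d v w z s e rewrite s | e with same (z (v + v)) (z (w + w))
... | false = refl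
... | true  = Bool.∧-zeroʳ (dead d (v + v) (w + w) z)

alive₂ : ∀ d v w z → link z (v + v) (suc (w + w)) ≡ true → dead d (v + v) (suc (w + w)) z ≡ false →
  dead (suc d) v w z ≡ false
alive₂ d v w z linked e rewrite even-double v | even-double+1 w
  with same (z (v + v)) (z (suc (w + w))) | same (z (v + v)) (z (w + w))
     | same (z (suc (v + v))) (z (suc (w + w))) | linked
... | true  | false | false | _  = e
... | true  | true  | _     | ()
... | true  | false | true  | ()
... | false | _     | _     | ()

survivor⇒alive : ∀ d v w z → Survivor z d v w → dead (suc d) v w z ≡ false
survivor⇒alive d v w z (survivor {p} {q} refl refl linked alive) with half-cases p | half-cases q
... | inj₁ p₀ | inj₁ q₀ = alive₀ d v w z
  (subst₂ (λ p q → same (z p) (z q) ≡ true) p₀ q₀ (proj₁ (∧-elim linked)))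
  (subst₂ (λ p q → dead d p q z ≡ false) p₀ q₀ alive)
... | inj₂ p₁ | inj₂ q₁ = alive₁ d v w z
  (subst₂ (λ p q → same (z p) (z q) ≡ true) p₁ q₁ (proj₁ (∧-elim linked)))
  (subst₂ (λ p q → dead d p q z ≡ false) p₁ q₁ alive)
... | inj₁ p₀ | inj₂ q₁ = alive₂ d v w z
  (subst₂ (λ p q → link z p q ≡ true) p₀ q₁ linked)
  (subst₂ (λ p q → dead d p q z ≡ false) p₀ q₁ alive)
-- The branching never produces the pair (2v + 1, 2w).
... | inj₂ p₁ | inj₁ q₀ = contradiction
    (subst₂ (λ p q → link z p q ≡ true) p₁ q₀ linked) (no-link v w)
  where
  no-link : ∀ v w → link z (suc (v + v)) (w + w) ≢ true
  no-link v w linked rewrite even-double+1 v | even-double w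
    with same (z (suc (v + v))) (z (w + w)) | linked
  ... | true  | ()
  ... | false | ()

-- The end nodes t and t′ encode the whole path, whose intermediate nodes are their shifts.
Path : Cantor → ℕ → ℕ → ℕ → ℕ → ℕ → Set
Path z d v w t t′ = t ≫ d ≡ v × t′ ≫ d ≡ w × (∀ δ → δ < d → link z (t ≫ δ) (t′ ≫ δ) ≡ true)

path⇒alive : ∀ d v w z {t t′} → Path z d v w t t′ → dead d v w z ≡ false
path⇒alive zero    v w z _ = refl
path⇒alive (suc d) v w z (eqv , eqw , links) = survivor⇒alive d v w z
  (survivor eqv eqw (links d ≤-refl)
    (path⇒alive d _ _ z (refl , refl , λ δ δ<d → links δ (m≤n⇒m≤1+n δ<d))))

alive⇒path : ∀ d v w z → dead d v w z ≡ false →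
  ∃[ t ] ∃[ t′ ] t < suc v * 2 ^ d × t′ < suc w * 2 ^ d × Path z d v w t t′
alive⇒path zero v w z _ = v , w , ≤-reflexive (sym (*-identityʳ _)) , ≤-reflexive (sym (*-identityʳ _)) ,
  refl , refl , λ _ ()
alive⇒path (suc d) v w z eq with alive⇒survivor d v w z eq
... | survivor {p} {q} half-p half-q linked alive with alive⇒path d p q z alive
...   | t , t′ , t< , t′< , eqp , eqq , links = t , t′ ,
    <-≤-trans t< (grow p half-p) , <-≤-trans t′< (grow q half-q) ,
    trans (cong ⌊_/2⌋ eqp) half-p , trans (cong ⌊_/2⌋ eqq) half-q , links′
  where
  grow : ∀ p {v} → ⌊ p /2⌋ ≡ v → suc p * 2 ^ d ≤ suc v * 2 ^ suc d
  grow p {v} refl = ≤-trans (*-monoˡ-≤ (2 ^ d) (half<⇒< p {suc v} ≤-refl)) (≤-reflexive (lemma (suc v) (2 ^ d)))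
    where
    lemma : ∀ a b → 2 * a * b ≡ a * (2 * b)
    lemma = solve-∀
  links′ : ∀ δ → δ < suc d → link z (t ≫ δ) (t′ ≫ δ) ≡ true
  links′ δ δ<1+d with m≤n⇒m<n∨m≡n (≤-pred δ<1+d)
  ... | inj₁ δ<d  = links δ δ<d
  ... | inj₂ refl = subst₂ (λ p q → link z p q ≡ true) (sym eqp) (sym eqq) linked

-- Replaces the branching recursion of `dead` by bounded quantifiers, the form in which survival can
-- be programmed with `any<` and `all<`.
pathBelow : ℕ → ℕ → ℕ → ℕ → Cantor → Bool
pathBelow N d v w z = anyBelow N λ t → anyBelow N λ t′ →
  (t ≫ d ≡ᵇ v) ∧ ((t′ ≫ d ≡ᵇ w) ∧ allBelow d (λ δ → link z (t ≫ δ) (t′ ≫ δ)))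

pathBelow≡alive : ∀ N d v w z → suc v * 2 ^ d ≤ N → suc w * 2 ^ d ≤ N →
  pathBelow N d v w z ≡ not (dead d v w z)
pathBelow≡alive N d v w z v-fits w-fits with dead d v w z in eq
... | false = found (alive⇒path d v w z eq)
  where
  found : ∃[ t ] ∃[ t′ ] t < suc v * 2 ^ d × t′ < suc w * 2 ^ d × Path z d v w t t′ → pathBelow N d v w z ≡ true
  found (t , t′ , t< , t′< , eqv , eqw , links) =
    anyBelow-intro (<-≤-trans t< v-fits) (anyBelow-intro (<-≤-trans t′< w-fits)
      (∧-intro (≡ᵇ-true eqv) (∧-intro (≡ᵇ-true eqw) (allBelow-intro links))))
... | true = not-true λ found → contradiction (trans (sym eq) (alive found)) λ ()
  where
  alive : pathBelow N d v w z ≡ true → dead d v w z ≡ false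
  alive found with anyBelow-elim {N} found
  ... | t , _ , found′ with anyBelow-elim {N} found′
  ...   | t′ , _ , conj = path⇒alive d v w z {t} {t′}
    ( ≡ᵇ-sound (t ≫ d) (proj₁ (∧-elim conj))
    , ≡ᵇ-sound (t′ ≫ d) (proj₁ (∧-elim rest))
    , λ δ δ<d → allBelow-elim {d} (proj₂ (∧-elim {t′ ≫ d ≡ᵇ w} rest)) δ<d )
    where
    rest = proj₂ (∧-elim {t ≫ d ≡ᵇ v} conj)

-- The events

-- Opaque, since conversion checking would otherwise unfold products and powers.
opaque
  depth : ℕ → ℕ
  depth K = 18 * K

  depth-mono : ∀ K → depth K ≤ depth (suc K)
  depth-mono K = *-monoʳ-≤ 18 (n≤1+n K)

  depth-correct : ∀ {k} (K : Fun k) v → code (lit 18 ⊗ K) ⟨ v ⟩↦ depth (fun K v)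
  depth-correct K = correct (lit 18 ⊗ K)

depthF : ∀ {k} → Fun k → Fun k
depthF K = mkFun (λ v → depth (fun K v)) (code (lit 18 ⊗ K)) (depth-correct K)

pairAt : ℕ → ℕ → ℕ → Bool
pairAt K v w = (v ≫ K ≡ᵇ 1) ∧ ((w ≫ K ≡ᵇ 1) ∧ not (v ≡ᵇ w))

pairDies : ℕ → ℕ → ℕ → Cantor → Bool
pairDies K v w z = pairAt K v w ∧ (not (dead (depth K) v w z) ∧ dead (suc (depth (suc K))) v w z)

someDies : ℕ → Cantor → Bool
someDies K z = anyBelow (2 ^ suc K) λ v → anyBelow (2 ^ suc K) λ w → pairDies K v w z

twins : ℕ → ℕ → Cantor → Bool
twins L u z = same (z (u + u)) (z (suc (u + u))) ∧ not (dead (depth (suc L)) (u + u) (suc (u + u)) z)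

twinsBelow : ℕ → ℕ → Cantor → Bool
twinsBelow L r z = anyBelow r λ i → twins L (2 ^ L + i) z

event : ℕ → Cantor → Bool
event L z = not (twinsBelow L (2 ^ L) z) ∨ someDies (suc L) z

limitPower : ∀ {k} → Fun k → Fun k
limitPower L = pow2 (lit 2 ⊕ L ⊕ (lit 1 ⊕ depthF (lit 2 ⊕ L)))

opaque
  -- Exceeds every node consulted by `event L`: these lie at most 18(L + 2) + 1 levels below nodes
  -- smaller than 2^(L + 2). It also serves as the window of the test.
  limit : ℕ → ℕ
  limit L = 2 ^ (2 + L + suc (depth (2 + L)))

  limit-correct : ∀ {k} (L : Fun k) v → code (limitPower L) ⟨ v ⟩↦ limit (fun L v)
  limit-correct L = correct (limitPower L)

  fits-limit : ∀ L v {d} → v < 2 ^ suc (suc L) → d ≤ suc (depth (suc (suc L))) → suc v * 2 ^ d ≤ limit L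
  fits-limit L v v< d≤ = ≤-trans (*-mono-≤ v< (^-monoʳ-≤ 2 d≤))
    (≤-reflexive (sym (^-distribˡ-+-* 2 (2 + L) (suc (depth (2 + L))))))

limitF : ∀ {k} → Fun k → Fun k
limitF L = mkFun (λ v → limit (fun L v)) (code (limitPower L)) (limit-correct L)

pairAt-sound : ∀ K v w → pairAt K v w ≡ true → Level K v × Level K w × v ≢ w
pairAt-sound K v w eq with ∧-elim {v ≫ K ≡ᵇ 1} eq
... | lv , eq′ with ∧-elim {w ≫ K ≡ᵇ 1} eq′
...   | lw , neq = ≡ᵇ-sound (v ≫ K) lv , ≡ᵇ-sound (w ≫ K) lw ,
        λ v≡w → contradiction (trans (sym neq) (cong not (≡ᵇ-true v≡w))) λ ()

pairAt-complete : ∀ K v w → Level K v → Level K w → v ≢ w → pairAt K v w ≡ true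
pairAt-complete K v w lv lw v≢w = ∧-intro (≡ᵇ-true lv) (∧-intro (≡ᵇ-true lw)
  (cong not (not-true {v ≡ᵇ w} (λ eq → v≢w (≡ᵇ-sound v eq)))))

≫<⇒< : ∀ c δ {b} → c ≫ δ < b → c < 2 ^ δ * b
≫<⇒< c zero    {b} lt = subst (c <_) (sym (+-identityʳ b)) lt
≫<⇒< c (suc δ) {b} lt = subst (c <_) (lemma (2 ^ δ) b) (≫<⇒< c δ (half<⇒< (c ≫ δ) lt))
  where
  lemma : ∀ a b → a * (2 * b) ≡ 2 * a * b
  lemma = solve-∀

level≢0 : ∀ l {v} → Level l v → v ≢ 0
level≢0 l lv refl = contradiction (trans (sym (0≫ l)) lv) λ ()

-- Positions 0 and 1 are left out because they are not labels of branches.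
Inner : ℕ → ℕ → Set
Inner L c = 2 ≤ c × c < limit L

descendant-inner : ∀ L c {v d δ} → v ≢ 0 → v < 2 ^ suc (suc L) → d ≤ suc (depth (suc (suc L))) →
  δ < d → c ≫ suc δ ≡ v → Inner L c
descendant-inner L c {v} {d} {δ} v≢0 v< d≤ δ<d refl = 2≤ c v≢0 ,
  <-≤-trans (≫<⇒< c (suc δ) ≤-refl)
    (≤-trans (≤-reflexive (*-comm (2 ^ suc δ) (suc v))) (fits-limit L v v< (≤-trans δ<d d≤)))
  where
  2≤ : ∀ c → c ≫ suc δ ≢ 0 → 2 ≤ c
  2≤ zero          ne = contradiction (0≫ (suc δ)) ne
  2≤ (suc zero)    ne = contradiction (1≫suc δ) ne
  2≤ (suc (suc c)) ne = s≤s (s≤s z≤n)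

dead-inner : ∀ L K {v w d} → Level K v → Level K w → v < 2 ^ suc (suc L) → w < 2 ^ suc (suc L) →
  d ≤ suc (depth (suc (suc L))) → DependsOn (dead d v w) (Inner L)
dead-inner L K {v} {w} {d} lv lw v< w< d≤ = dependsOn-mono inner (dead-local d v w)
  where
  inner : ∀ {c} → Under d v w c → Inner L c
  inner {c} (δ , δ<d , inj₁ eq) = descendant-inner L c (level≢0 K lv) v< d≤ δ<d eq
  inner {c} (δ , δ<d , inj₂ eq) = descendant-inner L c (level≢0 K lw) w< d≤ δ<d eq

pairDies-inner : ∀ L v w → v < 2 ^ suc (suc L) → w < 2 ^ suc (suc L) →
  DependsOn (pairDies (suc L) v w) (Inner L)
pairDies-inner L v w v< w< z z′ agree with pairAt (suc L) v w in eq
... | false = refl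
... | true with pairAt-sound (suc L) v w eq
...   | lv , lw , _ = cong₂ (λ a b → not a ∧ b)
  (dead-inner L (suc L) lv lw v< w< (≤-trans (depth-mono (suc L)) (n≤1+n _)) z z′ agree)
  (dead-inner L (suc L) lv lw v< w< ≤-refl z z′ agree)

level-offset : ∀ L i → i < 2 ^ L → Level L (2 ^ L + i)
level-offset zero    zero    _         = refl
level-offset zero    (suc i) (s≤s ())
level-offset (suc L) i       i<        = trans (≫-half (2 ^ suc L + i) L)
  (trans (cong (_≫ L) eq) (level-offset L ⌊ i /2⌋ half<))
  where
  double+half : ∀ a i → ⌊ a + a + i /2⌋ ≡ a + ⌊ i /2⌋
  double+half zero    i = refl
  double+half (suc a) i = trans (cong (λ b → ⌊ suc (b + i) /2⌋) (+-suc a a)) (cong suc (double+half a i))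
  eq : ⌊ 2 ^ suc L + i /2⌋ ≡ 2 ^ L + ⌊ i /2⌋
  eq = trans (cong (λ a → ⌊ 2 ^ L + a + i /2⌋) (+-identityʳ (2 ^ L))) (double+half (2 ^ L) i)
  half< : ⌊ i /2⌋ < 2 ^ L
  half< = ≰⇒> λ le → <⇒≱ i< (≤-trans (≤-reflexive (cong (2 ^ L +_) (+-identityʳ (2 ^ L))))
    (≤-trans (+-mono-≤ le le) (≤-trans (+-monoʳ-≤ ⌊ i /2⌋ (⌊n/2⌋≤⌈n/2⌉ i)) (≤-reflexive (⌊n/2⌋+⌈n/2⌉≡n i)))))

-- A single subtree is written with u twice, so that the disjointness lemma for pairs applies to it.
twins-local : ∀ L u → DependsOn (twins L u) (Under (suc (depth (suc L))) u u)
twins-local L u z z′ agree = cong₂ _∧_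
  (cong₂ same (agree (u + u) (0 , s≤s z≤n , inj₁ (half-double u)))
              (agree (suc (u + u)) (0 , s≤s z≤n , inj₁ (half-double+1 u))))
  (cong not (dead-local (depth (suc L)) (u + u) (suc (u + u)) z z′
    (λ n un → agree n (under-child (half-double u) (half-double+1 u) un))))

twins-inner : ∀ L i → i < 2 ^ L → DependsOn (twins L (2 ^ L + i)) (Inner L)
twins-inner L i i< = dependsOn-mono inner (twins-local L (2 ^ L + i))
  where
  u : ℕ
  u = 2 ^ L + i
  lu : Level L u
  lu = level-offset L i i<
  u< : u < 2 ^ suc (suc L)
  u< = <-≤-trans (level-bound L lu) (^-monoʳ-≤ 2 (n≤1+n (suc L)))
  inner : ∀ {c} → Under (suc (depth (suc L))) u u c → Inner L c
  inner {c} (δ , δ<d , inj₁ eq) = descendant-inner L c (level≢0 L lu) u< (s≤s (depth-mono (suc L))) δ<d eq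
  inner {c} (δ , δ<d , inj₂ eq) = descendant-inner L c (level≢0 L lu) u< (s≤s (depth-mono (suc L))) δ<d eq

event-inner : ∀ L → DependsOn (event L) (Inner L)
event-inner L z z′ agree = cong₂ _∨_
  (cong not (anyBelow-cong (2 ^ L) (λ i i< → twins-inner L i i< z z′ agree)))
  (anyBelow-cong (2 ^ suc (suc L)) (λ v v< → anyBelow-cong (2 ^ suc (suc L)) (λ w w< →
    pairDies-inner L v w v< w< z z′ agree)))

-- Probabilities of the events

*-^ : ∀ a b n → (a * b) ^ n ≡ a ^ n * b ^ n
*-^ a b zero    = refl
*-^ a b (suc n) = trans (cong (a * b *_) (*-^ a b n)) (lemma a b (a ^ n) (b ^ n))
  where
  lemma : ∀ a b x y → a * b * (x * y) ≡ a * x * (b * y)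
  lemma = solve-∀

n<2^n : ∀ n → n < 2 ^ n
n<2^n zero    = s≤s z≤n
n<2^n (suc n) = ≤-trans (+-mono-≤ (m^n>0 2 n) (n<2^n n)) (≤-reflexive (cong (2 ^ n +_) (sym (+-identityʳ (2 ^ n)))))

union-bound : ∀ m c b n (φ : ℕ → Cantor → Bool) → (∀ i → i < n → c * ∑ m (𝟙 ∘ φ i) ≤ b) →
  c * ∑ m (λ z → 𝟙 (anyBelow n (λ i → φ i z))) ≤ n * b
union-bound m c b zero    φ small = ≤-reflexive (trans (cong (c *_) (∑-zero m)) (*-zeroʳ c))
union-bound m c b (suc n) φ small = begin
  c * ∑ m (λ z → 𝟙 (φ n z ∨ anyBelow n (λ i → φ i z)))
    ≤⟨ *-monoʳ-≤ c (∑-∨ m (φ n) _) ⟩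
  c * (∑ m (𝟙 ∘ φ n) + ∑ m (λ z → 𝟙 (anyBelow n (λ i → φ i z))))
    ≡⟨ *-distribˡ-+ c (∑ m (𝟙 ∘ φ n)) _ ⟩
  c * ∑ m (𝟙 ∘ φ n) + c * ∑ m (λ z → 𝟙 (anyBelow n (λ i → φ i z)))
    ≤⟨ +-mono-≤ (small n ≤-refl) (union-bound m c b n φ (λ i i<n → small i (m≤n⇒m≤1+n i<n))) ⟩
  suc n * b ∎
  where open ≤-Reasoning

opaque
  unfolding depth

  deficit-at-depth : ∀ K h M → 8 ^ depth K * h ≤ 7 ^ depth K * M → 8 ^ K * h ≤ M
  deficit-at-depth K h M le = *-cancelˡ-≤ (8 ^ (17 * K)) {{m^n≢0 8 (17 * K)}} (begin
    8 ^ (17 * K) * (8 ^ K * h) ≡⟨ *-assoc (8 ^ (17 * K)) (8 ^ K) h ⟨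
    8 ^ (17 * K) * 8 ^ K * h   ≡⟨ cong (_* h) (^-distribˡ-+-* 8 (17 * K) K) ⟨
    8 ^ (17 * K + K) * h       ≡⟨ cong (λ e → 8 ^ e * h) (+-comm (17 * K) K) ⟩
    8 ^ (18 * K) * h           ≤⟨ le ⟩
    7 ^ (18 * K) * M           ≡⟨ cong (_* M) (^-*-assoc 7 18 K) ⟨
    (7 ^ 18) ^ K * M           ≤⟨ *-monoˡ-≤ M (^-monoˡ-≤ K (toWitness {a? = 7 ^ 18 ≤? 8 ^ 17} _)) ⟩
    (8 ^ 17) ^ K * M           ≡⟨ cong (_* M) (^-*-assoc 8 17 K) ⟩
    8 ^ (17 * K) * M           ∎)
    where open ≤-Reasoning

-- Extinction grows with depth, so dying between two depths has probability e′ - e. Since e′ is at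
-- most 1/2, this is at most half the deficit at the smaller depth.
pairDies-small : ∀ L m v w → limit L ≤ m → v < 2 ^ suc (suc L) → w < 2 ^ suc (suc L) →
  2 * 8 ^ suc L * ∑ m (𝟙 ∘ pairDies (suc L) v w) ≤ 2 ^ m
pairDies-small L m v w limit≤m v< w< with pairAt (suc L) v w in eq
... | false = subst (_≤ 2 ^ m) (sym (trans (cong (2 * 8 ^ suc L *_) (∑-zero m)) (*-zeroʳ (2 * 8 ^ suc L)))) z≤n
... | true with pairAt-sound (suc L) v w eq
...   | lv , lw , v≢w = begin
  2 * 8 ^ K * b   ≡⟨ trans (cong (_* b) (*-comm 2 (8 ^ K))) (*-assoc (8 ^ K) 2 b) ⟩
  8 ^ K * (2 * b) ≤⟨ *-monoʳ-≤ (8 ^ K) 2b≤h ⟩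
  8 ^ K * h       ≤⟨ deficit-at-depth K h (2 ^ m) (proj₂ (proj₂ shallow)) ⟩
  2 ^ m           ∎
  where
  open ≤-Reasoning
  K d D b e e′ h : ℕ
  K = suc L
  d = depth K
  D = suc (depth (suc K))
  b = ∑ m (λ z → 𝟙 (not (dead d v w z) ∧ dead D v w z))
  e = extinction m d v w
  e′ = extinction m D v w

  d≤D : d ≤ D
  d≤D = ≤-trans (depth-mono K) (n≤1+n _)

  fits : ∀ u {c} → u < 2 ^ suc (suc L) → c ≤ D → suc u * 2 ^ c ≤ m
  fits u u< c≤ = ≤-trans (fits-limit L u u< c≤) limit≤m

  shallow : ∃[ h ] 2 * e + h ≡ 2 ^ m × 8 ^ d * h ≤ 7 ^ d * 2 ^ m
  shallow = extinction-deficit m d K lv lw v≢w (fits v v< d≤D) (fits w w< d≤D)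

  deep : ∃[ h ] 2 * e′ + h ≡ 2 ^ m × 8 ^ D * h ≤ 7 ^ D * 2 ^ m
  deep = extinction-deficit m D K lv lw v≢w (fits v v< ≤-refl) (fits w w< ≤-refl)

  h = proj₁ shallow

  split : ∀ {a c} → (a ≡ true → c ≡ true) → 𝟙 (not a ∧ c) + 𝟙 a ≤ 𝟙 c
  split {false} {c} _  = ≤-reflexive (+-identityʳ (𝟙 c))
  split {true}  {c} mo = ≤-reflexive (cong 𝟙 (sym (mo refl)))

  b+e≤e′ : b + e ≤ e′
  b+e≤e′ = ≤-trans (≤-reflexive (sym (∑-+ m _ (𝟙 ∘ dead d v w))))
    (∑-mono m (λ z → split (dead-mono d≤D v w z)))

  2b≤h : 2 * b ≤ h
  2b≤h = +-cancelʳ-≤ (2 * e) (2 * b) h (begin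
    2 * b + 2 * e ≡⟨ *-distribˡ-+ 2 b e ⟨
    2 * (b + e)   ≤⟨ *-monoʳ-≤ 2 b+e≤e′ ⟩
    2 * e′        ≤⟨ m≤m+n (2 * e′) _ ⟩
    2 * e′ + proj₁ deep ≡⟨ trans (proj₁ (proj₂ deep)) (sym (proj₁ (proj₂ shallow))) ⟩
    2 * e + h     ≡⟨ +-comm (2 * e) h ⟩
    h + 2 * e     ∎)

-- Union bound over 4^(L + 2) pairs of probability at most 1/(2 · 8^(L + 1)) each, in total 2^-L.
someDies-small : ∀ L m → limit L ≤ m → 2 ^ L * ∑ m (𝟙 ∘ someDies (suc L)) ≤ 2 ^ m
someDies-small L m limit≤m = *-cancelˡ-≤ (2 * (a * (2 * a)))
  {{m*n≢0 2 (a * (2 * a)) {{_}} {{m*n≢0 a (2 * a) {{nz}} {{m*n≢0 2 a {{_}} {{nz}}}}}}}} (begin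
    2 * (a * (2 * a)) * (2 ^ L * S) ≡⟨ left (2 ^ L) S ⟩
    2 * (a * (a * a)) * S           ≡⟨ cong (λ e → 2 * e * S) (trans (*-^ 2 4 (suc L)) (cong (a *_) (*-^ 2 2 (suc L)))) ⟨
    2 * 8 ^ suc L * S               ≤⟨ union-bound m (2 * 8 ^ suc L) _ (2 ^ suc (suc L)) _ (λ v v< →
                                         union-bound m (2 * 8 ^ suc L) _ (2 ^ suc (suc L)) _ (λ w w< →
                                           pairDies-small L m v w limit≤m v< w<)) ⟩
    2 * a * (2 * a * 2 ^ m)         ≡⟨ right a (2 ^ m) ⟩
    2 * (a * (2 * a)) * 2 ^ m       ∎)
  where
  open ≤-Reasoning
  a S : ℕ
  a = 2 ^ suc L
  S = ∑ m (𝟙 ∘ someDies (suc L))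
  nz : NonZero a
  nz = m^n≢0 2 (suc L)
  left : ∀ b S → 2 * (2 * b * (2 * (2 * b))) * (b * S) ≡ 2 * (2 * b * (2 * b * (2 * b))) * S
  left = solve-∀
  right : ∀ a M → 2 * a * (2 * a * M) ≡ 2 * (a * (2 * a)) * M
  right = solve-∀

-- Failure means different labels, of probability 1/2, or equal labels with extinction, of
-- probability at most 1/2 · 1/2.
twins-likely : ∀ L m u → limit L ≤ m → Level L u → 4 * ∑ m (λ z → 𝟙 (not (twins L u z))) ≤ 3 * 2 ^ m
twins-likely L m u limit≤m lu = begin
  4 * ∑ m (λ z → 𝟙 (not (twins L u z)))
    ≡⟨ fresh₂ m (<-trans ≤-refl u₁<m) u₁<m (λ eq → double≢double+1 u u (sym eq))
         (λ a b z → 𝟙 (not (same a b ∧ not (dead d u₀ u₁ z)))) F-local ⟩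
  (∑ m (λ z → 𝟙 (not (not (dead d u₀ u₁ z)))) + ∑ m (λ _ → 1)) + (∑ m (λ _ → 1) + ∑ m (λ z → 𝟙 (not (not (dead d u₀ u₁ z)))))
    ≡⟨ cong₂ (λ a b → (a + b) + (b + a)) (∑-cong m (λ z → cong 𝟙 (Bool.not-involutive (dead d u₀ u₁ z)))) (∑-one m) ⟩
  (e + 2 ^ m) + (2 ^ m + e) ≡⟨ regroup e (2 ^ m) ⟩
  2 * e + 2 * 2 ^ m ≤⟨ +-monoˡ-≤ (2 * 2 ^ m) (subst (2 * e ≤_) (proj₁ (proj₂ deficit)) (m≤m+n (2 * e) _)) ⟩
  3 * 2 ^ m ∎
  where
  open ≤-Reasoning
  d u₀ u₁ e : ℕ
  d = depth (suc L)
  u₀ = u + u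
  u₁ = suc (u + u)
  e = extinction m d u₀ u₁

  lu₀ : Level (suc L) u₀
  lu₀ = level-double L u lu
  lu₁ : Level (suc L) u₁
  lu₁ = level-double+1 L u lu

  fits : ∀ v → Level (suc L) v → suc v * 2 ^ d ≤ m
  fits v lv = ≤-trans (fits-limit L v (level-bound (suc L) lv) (≤-trans (depth-mono (suc L)) (n≤1+n _))) limit≤m

  u₁<m : u₁ < m
  u₁<m = ≤-trans (m≤m*n (suc u₁) (2 ^ d) {{m^n≢0 2 d}}) (fits u₁ lu₁)

  deficit : ∃[ h ] 2 * e + h ≡ 2 ^ m × 8 ^ d * h ≤ 7 ^ d * 2 ^ m
  deficit = extinction-deficit m d (suc L) lu₀ lu₁ (double≢double+1 u u) (fits u₀ lu₀) (fits u₁ lu₁)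

  F-local : ∀ a b → DependsOn (λ z → 𝟙 (not (same a b ∧ not (dead d u₀ u₁ z)))) (λ n → n ≢ u₀ × n ≢ u₁)
  F-local a b z z′ agree = cong (λ x → 𝟙 (not (same a b ∧ not x))) (dead-local d u₀ u₁ z z′ (λ n un → agree n
    ((λ { refl → under-fresh (suc L) lu₀ lu₁ lu₀ un }) , (λ { refl → under-fresh (suc L) lu₀ lu₁ lu₁ un }))))

  regroup : ∀ e M → (e + M) + (M + e) ≡ 2 * e + 2 * M
  regroup = solve-∀

-- The failures at different nodes of level L are read off disjoint subtrees, so their probabilities
-- multiply.
twinsBelow-likely : ∀ L m r → limit L ≤ m → r ≤ 2 ^ L →
  4 ^ r * ∑ m (λ z → 𝟙 (not (twinsBelow L r z))) ≤ 3 ^ r * 2 ^ m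
twinsBelow-likely L m zero    limit≤m _   = ≤-reflexive (cong (_+ 0) (∑-one m))
twinsBelow-likely L m (suc r) limit≤m r<  = *-cancelˡ-≤ M {{m^n≢0 2 m}} (begin
  M * (4 ^ suc r * ∑ m (λ z → 𝟙 (not (twins L u z ∨ twinsBelow L r z))))
    ≡⟨ cong (λ s → M * (4 ^ suc r * s)) (∑-cong m (λ z → 𝟙-nor (twins L u z) _)) ⟩
  M * (4 ^ suc r * ∑ m (λ z → f z * g z)) ≡⟨ rotate M (4 ^ r) _ ⟩
  4 * 4 ^ r * (M * ∑ m (λ z → f z * g z))
    ≡⟨ cong (4 * 4 ^ r *_) (independent m (under? D u u) f-local g-local) ⟩
  4 * 4 ^ r * (∑ m f * ∑ m g)             ≡⟨ pair (4 ^ r) (∑ m f) (∑ m g) ⟩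
  4 * ∑ m f * (4 ^ r * ∑ m g)
    ≤⟨ *-mono-≤ (twins-likely L m u limit≤m lu) (twinsBelow-likely L m r limit≤m (<⇒≤ r<)) ⟩
  3 * M * (3 ^ r * M)                     ≡⟨ collect (3 ^ r) M ⟩
  M * (3 ^ suc r * M)                     ∎)
  where
  open ≤-Reasoning
  M D u : ℕ
  M = 2 ^ m
  D = suc (depth (suc L))
  u = 2 ^ L + r
  lu : Level L u
  lu = level-offset L r r<

  f g : Cantor → ℕ
  f z = 𝟙 (not (twins L u z))
  g z = 𝟙 (not (twinsBelow L r z))

  f-local : DependsOn f (Under D u u)
  f-local z z′ agree = cong (𝟙 ∘ not) (twins-local L u z z′ agree)

  g-local : DependsOn g (λ n → ¬ Under D u u n)
  g-local z z′ agree = cong (𝟙 ∘ not) (anyBelow-cong r (λ i i<r →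
    let u′  = 2 ^ L + i
        lu′ = level-offset L i (<-trans i<r r<)
        ne : u′ ≢ u
        ne eq = <⇒≢ i<r (+-cancelˡ-≡ (2 ^ L) i r eq)
    in twins-local L u′ z z′ (λ n un → agree n (under-disjoint L {D} {D} {u′} {u′} {u} {u} {n} lu′ lu′ lu lu ne ne ne ne un))))

  𝟙-nor : ∀ a b → 𝟙 (not (a ∨ b)) ≡ 𝟙 (not a) * 𝟙 (not b)
  𝟙-nor false b = sym (+-identityʳ (𝟙 (not b)))
  𝟙-nor true  b = refl
  rotate : ∀ M a s → M * (4 * a * s) ≡ 4 * a * (M * s)
  rotate = solve-∀
  pair : ∀ a x y → 4 * a * (x * y) ≡ 4 * x * (a * y)
  pair = solve-∀
  collect : ∀ b M → 3 * M * (b * M) ≡ M * (3 * b * M)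
  collect = solve-∀

-- With R = 2^k the bound is (3/4)^(8R), and 3^8 · 4 ≤ 4^8 makes it at most 4^-R. The offset 3 in
-- the level supplies the factor 8.
noTwins-small : ∀ k m → limit (3 + k) ≤ m →
  2 ^ (2 + k) * ∑ m (λ z → 𝟙 (not (twinsBelow (3 + k) (2 ^ (3 + k)) z))) ≤ 2 ^ m
noTwins-small k m limit≤m = *-cancelˡ-≤ ((3 ^ 8) ^ R) {{m^n≢0 (3 ^ 8) R}} (begin
  (3 ^ 8) ^ R * (2 ^ (2 + k) * A) ≤⟨ *-monoʳ-≤ ((3 ^ 8) ^ R) (*-monoˡ-≤ A exponent) ⟩
  (3 ^ 8) ^ R * (4 ^ R * A)       ≡⟨ *-assoc ((3 ^ 8) ^ R) (4 ^ R) A ⟨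
  (3 ^ 8) ^ R * 4 ^ R * A         ≡⟨ cong (_* A) (*-^ (3 ^ 8) 4 R) ⟨
  (3 ^ 8 * 4) ^ R * A             ≤⟨ *-monoˡ-≤ A (^-monoˡ-≤ R (toWitness {a? = 3 ^ 8 * 4 ≤? 4 ^ 8} _)) ⟩
  (4 ^ 8) ^ R * A                 ≡⟨ cong (_* A) (^-*-assoc 4 8 R) ⟩
  4 ^ (8 * R) * A                 ≡⟨ cong (λ r → 4 ^ r * A) eight ⟩
  4 ^ (2 ^ (3 + k)) * A           ≤⟨ twinsBelow-likely (3 + k) m (2 ^ (3 + k)) limit≤m ≤-refl ⟩
  3 ^ (2 ^ (3 + k)) * 2 ^ m       ≡⟨ cong (λ r → 3 ^ r * 2 ^ m) eight ⟨
  3 ^ (8 * R) * 2 ^ m             ≡⟨ cong (_* 2 ^ m) (^-*-assoc 3 8 R) ⟨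
  (3 ^ 8) ^ R * 2 ^ m             ∎)
  where
  open ≤-Reasoning
  R A : ℕ
  R = 2 ^ k
  A = ∑ m (λ z → 𝟙 (not (twinsBelow (3 + k) (2 ^ (3 + k)) z)))

  eight : 8 * R ≡ 2 ^ (3 + k)
  eight = lemma R
    where
    lemma : ∀ r → 8 * r ≡ 2 * (2 * (2 * r))
    lemma = solve-∀

  -- Because 2 + k = 1 + (1 + k) ≤ 2^k + 2^k.
  exponent : 2 ^ (2 + k) ≤ 4 ^ R
  exponent = ≤-trans (^-monoʳ-≤ 2 (+-mono-≤ (m^n>0 2 k) (≤-trans (n<2^n k) (≤-reflexive (sym (+-identityʳ R))))
    )) (≤-reflexive (sym (^-*-assoc 2 2 R)))

event-≤ : ∀ L m → ∑ m (𝟙 ∘ event L) ≤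
  ∑ m (λ z → 𝟙 (not (twinsBelow L (2 ^ L) z))) + ∑ m (𝟙 ∘ someDies (suc L))
event-≤ L m = ∑-∨ m (λ z → not (twinsBelow L (2 ^ L) z)) (someDies (suc L))

halves : ∀ {p q a b e M} → q ≤ p → e ≤ a + b → 2 * q * a ≤ M → 2 * p * b ≤ M → q * e ≤ M
halves {p} {q} {a} {b} {e} {M} q≤p e≤ a≤ b≤ = *-cancelˡ-≤ 2 (begin
  2 * (q * e)         ≡⟨ *-assoc 2 q e ⟨
  2 * q * e           ≤⟨ *-monoʳ-≤ (2 * q) e≤ ⟩
  2 * q * (a + b)     ≡⟨ *-distribˡ-+ (2 * q) a b ⟩
  2 * q * a + 2 * q * b ≤⟨ +-mono-≤ a≤ (≤-trans (*-monoˡ-≤ b (*-monoʳ-≤ 2 q≤p)) b≤) ⟩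
  M + M               ≡⟨ cong (M +_) (+-identityʳ M) ⟨
  2 * M               ∎)
  where open ≤-Reasoning

-- The two parts contribute at most 2^-(k + 2) and 2^-(k + 3).
event-small : ∀ k m → limit (3 + k) ≤ m → 2 ^ suc k * ∑ m (𝟙 ∘ event (3 + k)) ≤ 2 ^ m
event-small k m limit≤m = halves {2 ^ (2 + k)} (^-monoʳ-≤ 2 (n≤1+n (suc k)))
  (event-≤ (3 + k) m) (noTwins-small k m limit≤m) (someDies-small (3 + k) m limit≤m)

-- Decidability of the events

values : ∀ {k m} → Vec (Fun k) m → Vec ℕ k → Vec ℕ m
values []       v = []
values (a ∷ as) v = fun a v ∷ values as v

infix 9 _⟪_⟫

_⟪_⟫ : ∀ {k m} → Pred m → Vec (Fun k) m → Pred k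
p ⟪ as ⟫ = mkPred (λ v → holds p (values as v)) (comp (Pred.code p) (Vec.map code as))
  (λ v → comp (arguments as v) (Pred.correct p (values as v)))
  where
  arguments : ∀ {k m} (as : Vec (Fun k) m) v →
    Pointwise (λ g u → g ⟨ v ⟩↦ u) (Vec.map code as) (values as v)
  arguments []       v = []
  arguments (a ∷ as) v = correct a v ∷ arguments as v

evenP : ∀ {k} → Fun k → Pred k
evenP a = a ≐ (a ⊳ lit 1) ⊕ (a ⊳ lit 1)

sameP : ∀ {k} → Pred k → Pred k → Pred k
sameP p q = (p & q) or (neg p & neg q)

-- A string s of length N has the number c = suc (index s), whose binary digits are 1 followed by s.
label : ℕ → ℕ → Cantor
label N c j = not (even (c ≫ (suc N ∸ j)))

labelP : ∀ {k} → Fun k → Fun k → Fun k → Pred k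
labelP N c j = neg (evenP (c ⊳ ((lit 1 ⊕ N) ⊖ j)))

linkP : ∀ {k} → (Fun k → Pred k) → Fun k → Fun k → Pred k
linkP z p q = sameP (z p) (z q) & (sameP (evenP p) (evenP q)
  or ((evenP p & neg (evenP q)) & (neg (sameP (z p) (z (q ⊖ lit 1))) & neg (sameP (z (lit 1 ⊕ p)) (z q)))))

pathP : Pred 5
pathP = any< (var 0F) (any< (var 1F)
  ((var 1F ⊳ var 4F ≐ var 5F) & ((var 0F ⊳ var 4F ≐ var 6F)
    & all< (var 4F) (linkP (labelP (var 3F) (var 4F)) (var 2F ⊳ var 0F) (var 1F ⊳ var 0F)))))

twinsP : Pred 4
twinsP = sameP (labelP N c u₀) (labelP N c u₁) & pathP ⟪ N ∷ c ∷ depthF (lit 1 ⊕ L) ∷ u₀ ∷ u₁ ∷ [] ⟫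
  where
  i L N c u₀ u₁ : Fun 4
  i = var 0F
  L = var 1F
  N = var 2F
  c = var 3F
  u₀ = (pow2 L ⊕ i) ⊕ (pow2 L ⊕ i)
  u₁ = lit 1 ⊕ u₀

pairDiesP : Pred 5
pairDiesP = ((v ⊳ K ≐ lit 1) & ((w ⊳ K ≐ lit 1) & neg (v ≐ w)))
  & (pathP ⟪ N ∷ c ∷ depthF K ∷ v ∷ w ∷ [] ⟫ & neg (pathP ⟪ N ∷ c ∷ lit 1 ⊕ depthF (lit 1 ⊕ K) ∷ v ∷ w ∷ [] ⟫))
  where
  v w K N c : Fun 5
  w = var 0F
  v = var 1F
  K = lit 1 ⊕ var 2F
  N = var 3F
  c = var 4F

eventP : Pred 3
eventP = neg (any< (pow2 (var 0F)) twinsP)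
  or any< (pow2 (lit 2 ⊕ var 0F)) (any< (pow2 (lit 2 ⊕ var 1F)) pairDiesP)

-- By computation the value of `pathP` is `pathBelow` for the labelling coded by N and c.
pathP-spec : ∀ N c d v w → suc v * 2 ^ d ≤ N → suc w * 2 ^ d ≤ N →
  holds pathP (N ∷ c ∷ d ∷ v ∷ w ∷ []) ≡ not (dead d v w (label N c))
pathP-spec N c d v w = pathBelow≡alive N d v w (label N c)

twinsP-spec : ∀ L N c i → limit L ≤ N → i < 2 ^ L →
  holds twinsP (i ∷ L ∷ N ∷ c ∷ []) ≡ twins L (2 ^ L + i) (label N c)
twinsP-spec L N c i limit≤N i< = cong (same (label N c (u + u)) (label N c (suc (u + u))) ∧_)
  (pathP-spec N c (depth (suc L)) (u + u) (suc (u + u)) (fits (u + u) (half-double u)) (fits (suc (u + u)) (half-double+1 u)))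
  where
  u : ℕ
  u = 2 ^ L + i
  fits : ∀ v → ⌊ v /2⌋ ≡ u → suc v * 2 ^ depth (suc L) ≤ N
  fits v eq = ≤-trans (fits-limit L v (level-bound (suc L) (level-child L v eq (level-offset L i i<)))
    (≤-trans (depth-mono (suc L)) (n≤1+n _))) limit≤N

pairDiesP-spec : ∀ L N c v w → limit L ≤ N → v < 2 ^ suc (suc L) → w < 2 ^ suc (suc L) →
  holds pairDiesP (w ∷ v ∷ L ∷ N ∷ c ∷ []) ≡ pairDies (suc L) v w (label N c)
pairDiesP-spec L N c v w limit≤N v< w< = cong₂ (λ a b → pairAt (suc L) v w ∧ (a ∧ b))
  (pathP-spec N c (depth (suc L)) v w (fits v v< shallow) (fits w w< shallow))
  (trans (cong not (pathP-spec N c (suc (depth (suc (suc L)))) v w (fits v v< ≤-refl) (fits w w< ≤-refl)))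
    (Bool.not-involutive _))
  where
  shallow : depth (suc L) ≤ suc (depth (suc (suc L)))
  shallow = ≤-trans (depth-mono (suc L)) (n≤1+n _)
  fits : ∀ u {d} → u < 2 ^ suc (suc L) → d ≤ suc (depth (suc (suc L))) → suc u * 2 ^ d ≤ N
  fits u u< d≤ = ≤-trans (fits-limit L u u< d≤) limit≤N

eventP-spec : ∀ L N c → limit L ≤ N → holds eventP (L ∷ N ∷ c ∷ []) ≡ event L (label N c)
eventP-spec L N c limit≤N = cong₂ _∨_
  (cong not (anyBelow-cong (2 ^ L) (λ i → twinsP-spec L N c i limit≤N)))
  (anyBelow-cong (2 ^ suc (suc L)) (λ v v< → anyBelow-cong (2 ^ suc (suc L)) (λ w →
    pairDiesP-spec L N c v w limit≤N v<)))

-- The label of node c + 2 is bit c; nodes 0 and 1 carry no label, and the bits put there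
-- make the sequence coincide with the binary expansion of suc (index s).
labels : Cantor → Cantor
labels x = false ◂ true ◂ x

node-snoc : ∀ i b → ⌊ suc (snocIndex i b) /2⌋ ≡ suc i
node-snoc i false = cong suc (half-double i)
node-snoc i true  = cong suc (half-double+1 i)

node-parity : ∀ i b → not (even (suc (snocIndex i b))) ≡ b
node-parity i false = cong not (trans (cong (even ∘ suc) (sym (+-suc i i))) (even-double (suc i)))
node-parity i true  = cong not (trans (cong (even ∘ suc ∘ suc) (sym (+-suc i i))) (even-double+1 (suc i)))

node-root : ∀ i s → suc (List.foldl snocIndex i s) ≫ length s ≡ suc i
node-root i List.[]      = refl
node-root i (b List.∷ s) = trans (cong ⌊_/2⌋ (node-root (snocIndex i b) s)) (node-snoc i b)

-- The shift removes everything after bit j, which thereby becomes the parity of the remaining node.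
node-digit : ∀ i s j → j < length s →
  not (even (suc (List.foldl snocIndex i s) ≫ (length s ∸ suc j))) ≡ pad s j
node-digit i (b List.∷ s) zero    _         = trans (cong (not ∘ even) (node-root (snocIndex i b) s)) (node-parity i b)
node-digit i (b List.∷ s) (suc j) (s≤s j<n) = node-digit (snocIndex i b) s j j<n

label-string : ∀ L s → length s ≡ limit L → event L (label (limit L) (suc (index s))) ≡ event L (labels (pad s))
label-string L s len = event-inner L _ _ agree
  where
  agree : ∀ c → Inner L c → label (limit L) (suc (index s)) c ≡ labels (pad s) c
  agree (suc (suc j)) (s≤s (s≤s _) , j<) = trans
    (cong (λ n → not (even (suc (index s) ≫ (n ∸ suc j)))) (sym len))
    (node-digit 0 s j (subst (j <_) (sym len) (<-trans (n<1+n j) (<-trans (n<1+n (suc j)) j<))))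

-- The first conjunct says that the coded string has length N, since its node then lies at level N.
collisionTestP : Pred 2
collisionTestP = (c ⊳ N ≐ lit 1) & eventP ⟪ L ∷ N ∷ c ∷ [] ⟫
  where
  L N c : Fun 2
  L = lit 3 ⊕ var 0F
  N = limitF L
  c = lit 1 ⊕ var 1F

collisionTestP-spec : ∀ k i → holds collisionTestP (k ∷ i ∷ []) ≡
  (suc i ≫ limit (3 + k) ≡ᵇ 1) ∧ event (3 + k) (label (limit (3 + k)) (suc i))
collisionTestP-spec k i = cong ((suc i ≫ limit (3 + k) ≡ᵇ 1) ∧_) (eventP-spec (3 + k) (limit (3 + k)) (suc i) ≤-refl)

-- The events do not read bits 0 and 1, so all four settings of these contribute equally.
∑-labels : ∀ L m → ∑ (2 + m) (𝟙 ∘ event L) ≡ 4 * ∑ m (𝟙 ∘ event L ∘ labels)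
∑-labels L m = trans (cong₂ _+_ (cong₂ _+_ (same-∑ false false) (same-∑ false true))
                                (cong₂ _+_ (same-∑ true false) (same-∑ true true)))
  (four (∑ m (𝟙 ∘ event L ∘ labels)))
  where
  same-∑ : ∀ a b → ∑ m (λ x → 𝟙 (event L (a ◂ b ◂ x))) ≡ ∑ m (𝟙 ∘ event L ∘ labels)
  same-∑ a b = ∑-cong m (λ x → cong 𝟙 (event-inner L (a ◂ b ◂ x) (labels x) λ where
    (suc (suc c)) _              → refl
    (suc zero)    (s≤s () , _)))
  four : ∀ n → n + n + (n + n) ≡ 4 * n
  four = solve-∀

event-labels-small : ∀ k m → limit (3 + k) ≤ m → 2 ^ suc k * ∑ m (𝟙 ∘ event (3 + k) ∘ labels) ≤ 2 ^ m
event-labels-small k m limit≤m = *-cancelˡ-≤ 4 (begin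
  4 * (2 ^ suc k * ∑ m (𝟙 ∘ event (3 + k) ∘ labels)) ≡⟨ swap (2 ^ suc k) _ ⟩
  2 ^ suc k * (4 * ∑ m (𝟙 ∘ event (3 + k) ∘ labels)) ≡⟨ cong (2 ^ suc k *_) (∑-labels (3 + k) m) ⟨
  2 ^ suc k * ∑ (2 + m) (𝟙 ∘ event (3 + k))          ≤⟨ event-small k (2 + m) (≤-trans limit≤m (m≤n+m m 2)) ⟩
  2 ^ (2 + m)                                        ≡⟨ *-assoc 2 2 (2 ^ m) ⟨
  4 * 2 ^ m                                          ∎)
  where
  open ≤-Reasoning
  swap : ∀ a s → 4 * (a * s) ≡ a * (4 * s)
  swap = solve-∀

event-labels-local : ∀ L → DependsOn (event L ∘ labels) (_< limit L)
event-labels-local L x x′ agree = event-inner L (labels x) (labels x′) λ where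
  (suc (suc c)) (_ , c<) → agree c (<-trans (n<1+n c) (<-trans (n<1+n (suc c)) c<))
  (suc zero)    (s≤s () , _)

opaque
  unfolding limit

  n≤limit : ∀ n → n ≤ limit n
  n≤limit n = ≤-trans (<⇒≤ (n<2^n n)) (^-monoʳ-≤ 2 (≤-trans (m≤n+m n 2) (m≤m+n (2 + n) _)))

collisionTest : Test
collisionTest = record
  { event    = λ k x → event (3 + k) (labels x)
  ; window   = λ k → limit (3 + k)
  ; local    = λ k → event-labels-local (3 + k)
  ; grows    = λ k → ≤-trans (m≤n+m k 3) (n≤limit (3 + k))
  ; small    = event-labels-small
  ; decider  = collisionTestP
  ; sound    = sound
  ; complete = complete
  }
  where
  sound : ∀ k s → holds collisionTestP (k ∷ index s ∷ []) ≡ true →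
    length s ≡ limit (3 + k) × event (3 + k) (labels (pad s)) ≡ true
  sound k s accepted
    with ∧-elim {suc (index s) ≫ limit (3 + k) ≡ᵇ 1} (trans (sym (collisionTestP-spec k (index s))) accepted)
  ... | level , ev = len , trans (sym (label-string (3 + k) s len)) ev
    where
    len : length s ≡ limit (3 + k)
    len = level-unique {suc (index s)} (node-root 0 s) (≡ᵇ-sound (suc (index s) ≫ limit (3 + k)) level)

  complete : ∀ k s → length s ≡ limit (3 + k) → event (3 + k) (labels (pad s)) ≡ true →
    holds collisionTestP (k ∷ index s ∷ []) ≡ true
  complete k s len ev = trans (collisionTestP-spec k (index s))
    (∧-intro (≡ᵇ-true (subst (λ n → Level n (suc (index s))) len (node-root 0 s)))
             (trans (label-string (3 + k) s len) ev))

-- The collision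

Branch : (ℕ → ℕ) → Set
Branch V = V 0 ≡ 1 × (∀ j → ⌊ V (suc j) /2⌋ ≡ V j)

branchSequence : (ℕ → ℕ) → Cantor
branchSequence V j = not (even (V (suc j)))

↾-cong : ∀ {y y′} → y ≗ y′ → ∀ n → y ↾ n ≡ y′ ↾ n
↾-cong eq zero    = refl
↾-cong eq (suc n) = cong₂ List._∷_ (eq 0) (↾-cong (eq ∘ suc) n)

index-↾-suc : ∀ y j → index (y ↾ suc j) ≡ snocIndex (index (y ↾ j)) (y j)
index-↾-suc y j = trans (cong index (sym (applyUpTo-∷ʳ y j))) (foldl-∷ʳ snocIndex 0 (y j) (y ↾ j))

node-unsnoc : ∀ i c → ⌊ c /2⌋ ≡ suc i → suc (snocIndex i (not (even c))) ≡ c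
node-unsnoc i c half = [ (λ eq → left-node c (trans eq (cong₂ _+_ half half)))
                       , (λ eq → right-node c (trans eq (cong suc (cong₂ _+_ half half)))) ]′ (half-cases c)
  where
  left-node : ∀ c → c ≡ suc i + suc i → suc (snocIndex i (not (even c))) ≡ c
  left-node _ refl = trans (cong (λ b → suc (snocIndex i (not b))) (even-double (suc i))) (cong suc (sym (+-suc i i)))
  right-node : ∀ c → c ≡ suc (suc i + suc i) → suc (snocIndex i (not (even c))) ≡ c
  right-node _ refl = trans (cong (λ b → suc (snocIndex i (not b))) (even-double+1 (suc i))) (cong (suc ∘ suc) (sym (+-suc i i)))

branch-node : ∀ {V} → Branch V → ∀ j → suc (index (branchSequence V ↾ j)) ≡ V j
branch-node (root , _) zero = sym root
branch-node {V} branch@(_ , half) (suc j) = trans (cong suc (index-↾-suc (branchSequence V) j))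
  (node-unsnoc _ (V (suc j)) (trans (half j) (sym (branch-node branch j))))

labels-snoc : ∀ x i b → labels x (suc (snocIndex i b)) ≡ x (pred (snocIndex i b))
labels-snoc x i false = refl
labels-snoc x i true  = refl

-- Along a branch the online function outputs the labels below the root, so a collision amounts to
-- two branches with equal labels.
branch-value : ∀ x {V} → Branch V → ∀ j → F⟨ x ⟩ (branchSequence V) j ≡ labels x (V (suc j))
branch-value x {V} branch j = sym (begin
  labels x (V (suc j))                    ≡⟨ cong (labels x) (branch-node branch (suc j)) ⟨
  labels x (suc (index (y ↾ suc j)))      ≡⟨ cong (labels x ∘ suc) (index-↾-suc y j) ⟩
  labels x (suc (snocIndex i (y j)))      ≡⟨ labels-snoc x i (y j) ⟩
  x (pred (snocIndex i (y j)))            ≡⟨ cong (x ∘ pred) (index-↾-suc y j) ⟨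
  F⟨ x ⟩ y j                              ∎)
  where
  open ≡-Reasoning
  y : Cantor
  y = branchSequence V
  i : ℕ
  i = index (y ↾ j)

branch-agree : ∀ {V W} → Branch V → Branch W → ∀ a j → V (a + j) ≡ W (a + j) → V j ≡ W j
branch-agree bV bW zero    j eq = eq
branch-agree bV bW (suc a) j eq = branch-agree bV bW a j
  (trans (sym (proj₂ bV (a + j))) (trans (cong ⌊_/2⌋ eq) (proj₂ bW (a + j))))

same-sound : ∀ a b → same a b ≡ true → a ≡ b
same-sound false false _ = refl
same-sound true  true  _ = refl

record Pair (z : Cantor) (K : ℕ) : Set where
  field
    left right  : ℕ
    left-level  : Level K left
    right-level : Level K right
    distinct    : left ≢ right
    matched     : z left ≡ z right
    alive       : dead (depth K) left right z ≡ false

open Pair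

-- If no pair of level K dies, survival to `depth K` implies survival to `suc (depth (suc K))`. The
-- extra generation leaves a child pair that survives to `depth (suc K)`, which restores the
-- invariant.
extend : ∀ {z K} → someDies K z ≡ false → (p : Pair z K) → Survivor z (depth (suc K)) (left p) (right p)
extend {z} {K} none p = alive⇒survivor (depth (suc K)) (left p) (right p) z
  (not-true λ dies → contradiction (trans (sym none) (someDies-true dies)) λ ())
  where
  someDies-true : dead (suc (depth (suc K))) (left p) (right p) z ≡ true → someDies K z ≡ true
  someDies-true dies = anyBelow-intro (level-bound K (left-level p)) (anyBelow-intro (level-bound K (right-level p))
    (∧-intro (pairAt-complete K (left p) (right p) (left-level p) (right-level p) (distinct p))
      (∧-intro (cong not (alive p)) dies)))

next : ∀ {z K} → someDies K z ≡ false → Pair z K → Pair z (suc K)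
next {z} {K} none p = record
  { left        = Survivor.left s
  ; right       = Survivor.right s
  ; left-level  = level-child K _ (Survivor.left-child s) (left-level p)
  ; right-level = level-child K _ (Survivor.right-child s) (right-level p)
  ; distinct    = λ eq → distinct p
      (trans (sym (Survivor.left-child s)) (trans (cong ⌊_/2⌋ eq) (Survivor.right-child s)))
  ; matched     = same-sound _ _ (proj₁ (∧-elim (Survivor.linked s)))
  ; alive       = Survivor.alive s
  }
  where
  s : Survivor z (depth (suc K)) (left p) (right p)
  s = extend none p

module Continuation {z K} (start : Pair z K) (none : ∀ j → someDies (j + K) z ≡ false) where

  pairs : ∀ j → Pair z (j + K)
  pairs zero    = start
  pairs (suc j) = next (none j) (pairs j)

  module Side (side : ∀ {k} → Pair z k → ℕ)
    (side-level : ∀ {k} (p : Pair z k) → Level k (side p))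
    (side-half : ∀ {k} n (p : Pair z k) → ⌊ side (next n p) /2⌋ ≡ side p) where

    -- Pair j sits at level j + K, so shifting by K gives level j. This covers the ancestors of the
    -- starting node without a separate case.
    V : ℕ → ℕ
    V j = side (pairs j) ≫ K

    branch : Branch V
    branch = side-level start , λ j → trans (≫-half (side (pairs (suc j))) K)
      (cong (_≫ K) (side-half (none j) (pairs j)))

    ancestor : ∀ a i → side (pairs (a + i)) ≫ a ≡ side (pairs i)
    ancestor zero    i = refl
    ancestor (suc a) i = trans (≫-half (side (pairs (suc (a + i)))) a)
      (trans (cong (_≫ a) (side-half (none (a + i)) (pairs (a + i)))) (ancestor a i))

    branch-pairs : ∀ i → V (K + i) ≡ side (pairs i)
    branch-pairs = ancestor K

  module Left  = Side left left-level (λ n p → Survivor.left-child (extend n p))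
  module Right = Side right right-level (λ n p → Survivor.right-child (extend n p))

  matched-from : ∀ i → z (Left.V (K + i)) ≡ z (Right.V (K + i))
  matched-from i = trans (cong z (Left.branch-pairs i))
    (trans (matched (pairs i)) (cong z (sym (Right.branch-pairs i))))

  sequences-differ : ¬ (branchSequence Left.V ≗ branchSequence Right.V)
  sequences-differ eq = distinct start (begin
    left start                                     ≡⟨ Left.branch-pairs 0 ⟨
    Left.V (K + 0)                                 ≡⟨ branch-node Left.branch (K + 0) ⟨
    suc (index (branchSequence Left.V ↾ (K + 0)))  ≡⟨ cong (suc ∘ index) (↾-cong eq (K + 0)) ⟩
    suc (index (branchSequence Right.V ↾ (K + 0))) ≡⟨ branch-node Right.branch (K + 0) ⟩
    Right.V (K + 0)                                ≡⟨ Right.branch-pairs 0 ⟩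
    right start                                    ∎)
    where open ≡-Reasoning

siblings : ∀ {z} L → twinsBelow L (2 ^ L) z ≡ true → ∃[ p ] ⌊ left {z} {suc L} p /2⌋ ≡ ⌊ right p /2⌋
siblings {z} L found = from-index (anyBelow-elim {2 ^ L} found)
  where
  from-index : ∃[ i ] i < 2 ^ L × twins L (2 ^ L + i) z ≡ true →
    ∃[ p ] ⌊ left {z} {suc L} p /2⌋ ≡ ⌊ right p /2⌋
  from-index (i , i< , tw) = record
    { left        = u + u
    ; right       = suc (u + u)
    ; left-level  = level-double L u (level-offset L i i<)
    ; right-level = level-double+1 L u (level-offset L i i<)
    ; distinct    = double≢double+1 u u
    ; matched     = same-sound _ _ (proj₁ (∧-elim tw))
    ; alive       = Bool.not-injective (proj₂ (∧-elim {same (z (u + u)) (z (suc (u + u)))} tw))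
    } , trans (half-double u) (sym (half-double+1 u))
    where
    u : ℕ
    u = 2 ^ L + i

module Collision {x L} (start : Pair (labels x) (suc L)) (siblings : ⌊ left start /2⌋ ≡ ⌊ right start /2⌋)
  (none : ∀ j → someDies (j + suc L) (labels x) ≡ false) where

  open Continuation start none public

  z : Cantor
  z = labels x

  common-ancestor : Left.V L ≡ Right.V L
  common-ancestor = begin
    Left.V L                        ≡⟨ proj₂ Left.branch L ⟨
    ⌊ Left.V (suc L) /2⌋            ≡⟨ cong (⌊_/2⌋ ∘ Left.V) (+-identityʳ (suc L)) ⟨
    ⌊ Left.V (suc L + 0) /2⌋        ≡⟨ cong ⌊_/2⌋ (Left.branch-pairs 0) ⟩
    ⌊ left start /2⌋  ≡⟨ siblings ⟩
    ⌊ right start /2⌋ ≡⟨ cong ⌊_/2⌋ (Right.branch-pairs 0) ⟨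
    ⌊ Right.V (suc L + 0) /2⌋       ≡⟨ cong (⌊_/2⌋ ∘ Right.V) (+-identityʳ (suc L)) ⟩
    ⌊ Right.V (suc L) /2⌋           ≡⟨ proj₂ Right.branch L ⟩
    Right.V L                       ∎
    where open ≡-Reasoning

  -- Down to level L the two branches coincide because the starting nodes are siblings; from level L
  -- + 1 on the construction matches their labels.
  matched-everywhere : ∀ j → z (Left.V j) ≡ z (Right.V j)
  matched-everywhere j = [ above , below ]′ (≤-<-connex j L)
    where
    above : j ≤ L → z (Left.V j) ≡ z (Right.V j)
    above j≤L = cong z (branch-agree Left.branch Right.branch (L ∸ j) j
      (subst (λ n → Left.V n ≡ Right.V n) (sym (m∸n+n≡m j≤L)) common-ancestor))
    below : L < j → z (Left.V j) ≡ z (Right.V j)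
    below L<j = subst (λ n → z (Left.V n) ≡ z (Right.V n)) (m+[n∸m]≡n L<j) (matched-from (j ∸ suc L))

  collision : F⟨ x ⟩ (branchSequence Left.V) ≗ F⟨ x ⟩ (branchSequence Right.V)
  collision j = trans (branch-value x Left.branch j)
    (trans (matched-everywhere (suc j)) (sym (branch-value x Right.branch j)))

events-avoided⇒collision : ∀ x L → (∀ j → event (j + L) (labels x) ≡ false) →
  ∃[ y ] ∃[ y′ ] F⟨ x ⟩ y ≗ F⟨ x ⟩ y′ × ¬ (y ≗ y′)
events-avoided⇒collision x L avoided = _ , _ , collision , sequences-differ
  where
  twins-or-none : ∀ K → event K (labels x) ≡ false →
    twinsBelow K (2 ^ K) (labels x) ≡ true × someDies (suc K) (labels x) ≡ false
  twins-or-none K ev with ∨-false {not (twinsBelow K (2 ^ K) (labels x))} ev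
  ... | twinsFound , none = not-false twinsFound , none

  none : ∀ j → someDies (j + suc L) (labels x) ≡ false
  none j = subst (λ K → someDies K (labels x) ≡ false) (sym (+-suc j L))
    (proj₂ (twins-or-none (j + L) (avoided j)))

  start : ∃[ p ] ⌊ left {labels x} {suc L} p /2⌋ ≡ ⌊ right p /2⌋
  start = siblings L (proj₁ (twins-or-none L (avoided 0)))

  open Collision {x} {L} (proj₁ start) (proj₂ start) none

corollary5p4 : (F : Cantor → Cantor) → RandomOnline F → ¬ OneToOne F
corollary5p4 F (x , random , F≗) injective = random-avoids collisionTest random λ n avoided →
  -- The event with test index k belongs to level k + 3.
  separate (events-avoided⇒collision x (3 + n)
    (λ j → subst (λ L → event L (labels x) ≡ false) (shift n j) (avoided j)))
  where
  shift : ∀ n j → 3 + (n + j) ≡ j + (3 + n)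
  shift = solve-∀
  separate : ¬ (∃[ y ] ∃[ y′ ] F⟨ x ⟩ y ≗ F⟨ x ⟩ y′ × ¬ (y ≗ y′))
  separate (y , y′ , collide , differ) =
    differ (injective λ j → trans (F≗ y j) (trans (collide j) (sym (F≗ y′ j))))
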